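{- Let $x,y,z_1,z_2$ be indeterminates. For every integer $n\ge 2$, the two types of adjacent-boundary doubly-refined ASM generating function are related by $$\begin{aligned} &\bigl((z_1-1)(z_2-1)-yz_1z_2\bigr)\,Z^{\mathrm{adj}}_n(x,y;z_1,z_2)-\bigl(x(z_1-1)(z_2-1)-y\bigr)\,z_1z_2\,\widetilde{Z}^{\mathrm{adj}}_n(x,y;z_1,z_2)\\ &\qquad=(z_1-1)(z_2-1)\bigl(1-(xz_1z_2)^n\bigr)\,Z_{n-1}(x,y). \end{aligned}$$
   Context: An alternating sign matrix (ASM) is a square matrix with entries in $\{0,1,-1\}$ such that along each row and each column the nonzero entries alternate in sign and sum to $1$. $\mathrm{ASM}(n)$ is the set of $n\times n$ ASMs. The first and last rows and columns of an ASM each contain exactly one $1$, all other entries there being $0$. For $A\in\mathrm{ASM}(n)$ define: $\nu(A)=\sum_{1\le i<i'\le n,\;1\le j'\le j\le n}A_{ij}A_{i'j'}$ (a nonnegative integer); $\mu(A)=$ number of $-1$'s in $A$; $\rho_{\mathrm T}(A)=$ number of $0$'s to the left of the $1$ in the top row; $\rho_{\mathrm R}(A)=$ number of $0$'s below the $1$ in the right-most column; $\rho_{\mathrm L}(A)=$ number of $0$'s above the $1$ in the left-most column. Generating functions (for $n\ge1$): $Z^{\mathrm{adj}}_n(x,y;z_1,z_2)=\sum_{A\in\mathrm{ASM}(n)}x^{\nu(A)}y^{\mu(A)}z_1^{\rho_{\mathrm T}(A)}z_2^{\rho_{\mathrm L}(A)}$; $\widetilde{Z}^{\mathrm{adj}}_n(x,y;z_1,z_2)=\sum_{A\in\mathrm{ASM}(n)}x^{\nu(A)}y^{\mu(A)}z_1^{\rho_{\mathrm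 T}(A)}z_2^{\rho_{\mathrm R}(A)}$; $Z_n(x,y)=\sum_{A\in\mathrm{ASM}(n)}x^{\nu(A)}y^{\mu(A)}$. -}

module Defs where

open import Algebra.Bundles using (CommutativeRing)
open import Data.Bool.Base using (if_then_else_)
open import Data.Fin.Base using (Fin)
import Data.Fin.Properties as Fin
open import Data.Integer.Base using (ℤ; 0ℤ; 1ℤ; -1ℤ; -_; ∣_∣) renaming (_*_ to _*ℤ_)
open import Data.Integer.Properties using (_≟_; +-0-monoid)
open import Data.List.Base as List using (List; []; _∷_; [_]; cartesianProductWith; takeWhile)
open import Data.List.Membership.DecPropositional _≟_ using (_∈?_)
open import Data.List.Membership.Propositional using (_∈_)
open import Data.List.Membership.Propositional.Properties
  using (∈-cartesianProductWith⁺; ∈-filter⁺; ∈-filter⁻)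
open import Data.List.Relation.Unary.All using ([]; _∷_)
open import Data.List.Relation.Unary.AllPairs using ([]; _∷_)
open import Data.List.Relation.Unary.Any using (here)
open import Data.List.Relation.Unary.Linked using (Linked; linked?)
open import Data.List.Relation.Unary.Unique.Propositional using (Unique)
open import Data.List.Relation.Unary.Unique.Propositional.Properties
  using (cartesianProductWith⁺; filter⁺)
open import Data.Nat.Base using (ℕ; zero; suc; NonZero)
open import Data.Product.Base using (_×_; _,_; proj₁; proj₂)
open import Data.Vec.Base as Vec using (Vec; []; _∷_; lookup; toList; transpose; reverse; count)
open import Data.Vec.Properties using (∷-injective)
open import Data.Vec.Relation.Unary.All as All using (All; []; _∷_)
open import Function.Base using (_∘_)
open import Function.Bundles using (_⇔_; mk⇔)
open import Relation.Binary.PropositionalEquality using (_≡_; refl)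
open import Relation.Nullary.Decidable using (Dec; does; ¬?; _×-dec_)

open import Algebra.Properties.Monoid.Sum +-0-monoid using (sum; sum-syntax)

Matrix : ℕ → Set
Matrix n = Vec (Vec ℤ n) n

infixl 9 _⟨_,_⟩
_⟨_,_⟩ : ∀ {n} → Matrix n → Fin n → Fin n → ℤ
A ⟨ i , j ⟩ = lookup (lookup A i) j

entries : List ℤ
entries = 0ℤ ∷ 1ℤ ∷ -1ℤ ∷ []

-- For entries in {0,1,-1}, two consecutive nonzero entries have opposite
-- signs exactly when each is the negative of the other.
Alternating : ∀ {n} → Vec ℤ n → Set
Alternating v = Linked (λ a b → a ≡ - b) (List.filter (¬? ∘ (_≟ 0ℤ)) (toList v))

IsASMLine : ∀ {n} → Vec ℤ n → Set
IsASMLine v = Alternating v × sum (lookup v) ≡ 1ℤ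

IsASM : ∀ {n} → Matrix n → Set
IsASM A = All (All (_∈ entries)) A × All IsASMLine A × All IsASMLine (transpose A)

isASMLine? : ∀ {n} (v : Vec ℤ n) → Dec (IsASMLine v)
isASMLine? v = linked? (λ a b → a ≟ - b) _ ×-dec (sum (lookup v) ≟ 1ℤ)

isASM? : ∀ {n} (A : Matrix n) → Dec (IsASM A)
isASM? A = All.all? (All.all? (_∈? entries)) A
     ×-dec All.all? isASMLine? A
     ×-dec All.all? isASMLine? (transpose A)

vecsOver : ∀ {a} {A : Set a} → List A → (n : ℕ) → List (Vec A n)
vecsOver xs zero    = [ [] ]
vecsOver xs (suc n) = cartesianProductWith _∷_ xs (vecsOver xs n)

ASM : (n : ℕ) → List (Matrix n)
ASM n = List.filter isASM? (vecsOver (vecsOver entries n) n)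

∈-vecsOver : ∀ {a} {A : Set a} {xs : List A} {n} {v : Vec A n} →
             All (_∈ xs) v → v ∈ vecsOver xs n
∈-vecsOver []         = here refl
∈-vecsOver (px ∷ pxs) = ∈-cartesianProductWith⁺ _∷_ px (∈-vecsOver pxs)

vecsOver-unique : ∀ {a} {A : Set a} {xs : List A} →
                  Unique xs → ∀ n → Unique (vecsOver xs n)
vecsOver-unique xs! zero    = [] ∷ []
vecsOver-unique xs! (suc n) =
  cartesianProductWith⁺ _∷_ ∷-injective xs! (vecsOver-unique xs! n)

∈-ASM : ∀ {n} {A : Matrix n} → A ∈ ASM n ⇔ IsASM A
∈-ASM {n} = mk⇔
  (λ A∈ → proj₂ (∈-filter⁻ isASM? {xs = vecsOver (vecsOver entries n) n} A∈))
  (λ asm → ∈-filter⁺ isASM? (∈-vecsOver (All.map ∈-vecsOver (proj₁ asm))) asm)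

ASM-unique : ∀ n → Unique (ASM n)
ASM-unique n = filter⁺ isASM? (vecsOver-unique (vecsOver-unique entries! n) n)
  where
  entries! : Unique entries
  entries! = ((λ ()) ∷ (λ ()) ∷ []) ∷ ((λ ()) ∷ []) ∷ [] ∷ []

inversionSum : ∀ {n} → Matrix n → ℤ
inversionSum {n} A =
  ∑[ i < n ] ∑[ i′ < n ] ∑[ j < n ] ∑[ j′ < n ]
    (if does (i Fin.<? i′ ×-dec j′ Fin.≤? j) then A ⟨ i , j ⟩ *ℤ A ⟨ i′ , j′ ⟩ else 0ℤ)

-- The sum is nonnegative for every alternating sign matrix, so the absolute
-- value only changes its type.
ν : ∀ {n} → Matrix n → ℕ
ν A = ∣ inversionSum A ∣

μ : ∀ {n} → Matrix n → ℕ
μ A = count (_≟ -1ℤ) (Vec.concat A)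

zerosBeforeOne : ∀ {n} → Vec ℤ n → ℕ
zerosBeforeOne v =
  List.length (List.filter (_≟ 0ℤ) (takeWhile (¬? ∘ (_≟ 1ℤ)) (toList v)))

-- Rows are listed from top to bottom, and each row from left to right; the
-- last column is reversed because ρR counts below the 1.
ρT ρR ρL : ∀ {m} → Matrix (suc m) → ℕ
ρT A = zerosBeforeOne (Vec.head A)
ρR A = zerosBeforeOne (reverse (Vec.last (transpose A)))
ρL A = zerosBeforeOne (Vec.head (transpose A))

-- Generating functions, evaluated at elements of a commutative ring R.
-- The case of indeterminates is R = ℤ[x,y,z₁,z₂].
module GeneratingFunctions {c ℓ} (R : CommutativeRing c ℓ) where

  open CommutativeRing R using (Carrier; _+_; _*_; 0#; semiring)
  open import Algebra.Properties.Semiring.Exp semiring public using (_^_)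

  sumASM : (n : ℕ) → (Matrix n → Carrier) → Carrier
  sumASM n f = List.foldr _+_ 0# (List.map f (ASM n))

  Z : (n : ℕ) (x y : Carrier) → Carrier
  Z n x y = sumASM n λ A → x ^ ν A * y ^ μ A

  Zadj Z̃adj : (n : ℕ) .{{_ : NonZero n}} → (x y z₁ z₂ : Carrier) → Carrier
  Zadj (suc m) x y z₁ z₂ =
    sumASM (suc m) λ A → x ^ ν A * y ^ μ A * z₁ ^ ρT A * z₂ ^ ρL A
  Z̃adj (suc m) x y z₁ z₂ =
    sumASM (suc m) λ A → x ^ ν A * y ^ μ A * z₁ ^ ρT A * z₂ ^ ρR A

{-# OPTIONS --safe #-}
module Submission where

-- The partial sums h to the left of and v above the entries turn an alternating
-- sign matrix into a six-vertex configuration: μ counts the entries -1, and ν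
-- counts the zeros at which both partial sums are one. Giving one row the
-- parameter z₂ and the first column the parameter z₁ produces the
-- boundary-refined weights. By the Yang–Baxter equation, in a form that avoids
-- division, the row of parameter z₂ may be moved from the top to the bottom,
-- provided the vertex where it meets the first column has the right weights.
-- At the top, the sum over configurations is a combination of Zadj and Z (the
-- latter from the matrices with a one in the corner), at the bottom, it is a
-- combination of Z̃adj and Z; equating the two gives the identity. Bottom rows
-- rather than right columns occur because all matrices are transposed.

open import Defs
open import Algebra.Bundles using (CommutativeRing; RawRing)
open import Algebra.Solver.Ring.AlmostCommutativeRing
  using (fromCommutativeRing; _-Raw-AlmostCommutative⟶_)
open import Data.Bool.Base using (Bool; true; false; if_then_else_; _∧_)
open import Data.Fin.Base using (Fin; zero; suc)
import Data.Fin.Properties as Fin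
open import Data.Integer.Base as ℤ using (ℤ; +_; -[1+_]; 0ℤ; 1ℤ; -1ℤ)
import Data.Integer.Properties as ℤ
open import Data.List.Base as List using (List; []; _∷_; cartesianProductWith)
open import Data.List.Membership.Propositional using (_∈_)
open import Data.List.Membership.Propositional.Properties using (∈-map⁺; ∈-map⁻)
open import Data.List.Membership.Propositional.Properties.WithK using (unique∧set⇒bag)
import Data.List.Properties as List
open import Data.List.Relation.Binary.BagAndSetEquality using (∼bag⇒↭)
import Data.List.Relation.Binary.Permutation.Homogeneous as Homogeneous
open import Data.List.Relation.Binary.Permutation.Propositional using (_↭_; ↭⇒↭ₛ)
import Data.List.Relation.Binary.Permutation.Propositional.Properties as ↭
import Data.List.Relation.Binary.Permutation.Setoid.Properties as ↭ₛ
open import Data.List.Relation.Unary.Any using (here; there)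
open import Data.List.Relation.Unary.Linked using (Linked; []; [-]; _∷_)
import Data.List.Relation.Unary.Unique.Propositional.Properties as Unique
open import Data.Maybe.Base as Maybe using (Maybe; just; nothing; maybe′)
open import Data.Nat.Base as ℕ using (ℕ; zero; suc; _∸_)
import Data.Nat.Properties as ℕ
open import Data.Nat.Tactic.RingSolver using (solve-∀)
open import Data.Product.Base using (_×_; _,_; ∃; ∃₂)
open import Data.Sum.Base using (_⊎_; inj₁; inj₂)
open import Data.Vec.Base as Vec using (Vec; []; _∷_; replicate; lookup; toList; transpose)
import Data.Vec.Properties as Vec
open import Data.Vec.Relation.Unary.All as All using (All; []; _∷_)
open import Data.Vec.Relation.Unary.All.Properties using (lookup⁺; lookup⁻)
open import Function.Base using (_∘_; case_of_)
open import Function.Bundles using (Equivalence; mk⇔)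
open import Level using (_⊔_)
open import Relation.Binary.Consequences using (dec⇒weaklyDec)
open import Relation.Binary.PropositionalEquality as ≡ using (_≡_; cong; cong₂; subst)
open import Relation.Nullary.Decidable using (Dec; does; yes; no; ¬?; _×-dec_)
open import Relation.Nullary.Negation using (¬_; contradiction)

-- The two coefficients in the identity are `- a∗` and `- b∗`. Moving the row requires the weights
-- `a∗`, `b∗`, `y` at the crossing vertex, whereas the generating functions have `z₁ * z₂`, 1, 1
-- there. The configurations are therefore sorted by that vertex: apart from those with a one in the
-- corner, it is `a₀` when the row is at the top and `b` when it is at the bottom. Suitable
-- multiples of the generating functions make these two classes cancel, so only matrices with a
-- corner one remain. Deleting the row and the column of that one leaves size n - 1. A one in the
-- top corner adds no factor and a one in the bottom corner adds `(x * z₁ * z₂) ^ (n - 1)`; this is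
-- the origin of the factor with the n-th power. Division is an obstacle because the ring is
-- arbitrary and `y` may be a zero divisor. The quotient by `y` is instead carried along as data,
-- computed column by column.

-- A ring solver with integer coefficients over an arbitrary commutative ring.

module IntegerCoefficientSolver {c ℓ} (R : CommutativeRing c ℓ) where

  open CommutativeRing R
  open import Algebra.Properties.Semiring.Mult.TCOptimised semiring
    using (×-homo-+; ×1-homo-*) renaming (_×_ to _×ᴿ_)
  open import Algebra.Properties.Ring ring using (-‿distribˡ-*; -‿distribʳ-*)
  open import Algebra.Properties.AbelianGroup +-abelianGroup
    using (⁻¹-∙-comm; ⁻¹-involutive; ε⁻¹≈ε)
  open import Algebra.Properties.CommutativeSemigroup +-commutativeSemigroup
    using (interchange)
  open import Relation.Binary.Reasoning.Setoid setoid

  -- The pair (m , n) stands for the integer m - n. Sums and products are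
  -- reduced so that equal integers are represented by equal pairs.
  reduce : ℕ → ℕ → ℕ × ℕ
  reduce m n = m ℕ.∸ n , n ℕ.∸ m

  differences : RawRing _ _
  differences = record
    { Carrier = ℕ × ℕ
    ; _≈_     = _≡_
    ; _+_     = λ (a , b) (c , d) → reduce (a ℕ.+ c) (b ℕ.+ d)
    ; _*_     = λ (a , b) (c , d) → reduce (a ℕ.* c ℕ.+ b ℕ.* d) (a ℕ.* d ℕ.+ b ℕ.* c)
    ; -_      = λ (a , b) → b , a
    ; 0#      = 0 , 0
    ; 1#      = 1 , 0
    }

  module D = RawRing differences

  ι : ℕ → Carrier
  ι n = n ×ᴿ 1#

  -- The case distinction makes ⟦ 1 , 0 ⟧ reduce to 1#.
  ⟦_⟧ : ℕ × ℕ → Carrier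
  ⟦ m , zero  ⟧ = ι m
  ⟦ m , suc n ⟧ = ι m - ι (suc n)

  ⟦⟧-difference : ∀ m n → ⟦ m , n ⟧ ≈ ι m - ι n
  ⟦⟧-difference m zero    = sym (trans (+-congˡ ε⁻¹≈ε) (+-identityʳ _))
  ⟦⟧-difference m (suc n) = refl

  ⟦⟧-reduce : ∀ m n → ⟦ reduce m n ⟧ ≈ ι m - ι n
  ⟦⟧-reduce zero    zero    = ⟦⟧-difference 0 0
  ⟦⟧-reduce zero    (suc n) = refl
  ⟦⟧-reduce (suc m) zero    = ⟦⟧-difference (suc m) 0
  ⟦⟧-reduce (suc m) (suc n) = begin
    ⟦ reduce m n ⟧                    ≈⟨ ⟦⟧-reduce m n ⟩
    ι m - ι n                         ≈⟨ +-identityˡ _ ⟨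
    0# + (ι m - ι n)                  ≈⟨ +-congʳ (-‿inverseʳ 1#) ⟨
    (1# - 1#) + (ι m - ι n)           ≈⟨ interchange _ _ _ _ ⟩
    (1# + ι m) + (- 1# - ι n)         ≈⟨ +-congˡ (⁻¹-∙-comm _ _) ⟩
    (1# + ι m) - (1# + ι n)           ≈⟨ +-cong (×-homo-+ 1# 1 m) (-‿cong (×-homo-+ 1# 1 n)) ⟨
    ι (suc m) - ι (suc n)             ∎

  difference-* : ∀ a b c d → (a * c + b * d) - (a * d + b * c) ≈ (a - b) * (c - d)
  difference-* a b c d = begin
    (a * c + b * d) - (a * d + b * c)
      ≈⟨ +-congˡ (⁻¹-∙-comm _ _) ⟨
    (a * c + b * d) + (- (a * d) + - (b * c))
      ≈⟨ interchange _ _ _ _ ⟩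
    (a * c + - (a * d)) + (b * d + - (b * c))
      ≈⟨ +-cong (+-congˡ (-‿distribʳ-* a d))
                (trans (+-comm _ _) (+-cong (-‿distribˡ-* b c) -b*-d≈b*d)) ⟩
    (a * c + a * - d) + (- b * c + - b * - d)
      ≈⟨ +-cong (distribˡ a c (- d)) (distribˡ (- b) c (- d)) ⟨
    a * (c - d) + - b * (c - d)
      ≈⟨ distribʳ (c - d) a (- b) ⟨
    (a - b) * (c - d) ∎
    where
    -b*-d≈b*d : b * d ≈ - b * - d
    -b*-d≈b*d =
      trans (sym (⁻¹-involutive _)) (trans (-‿cong (-‿distribʳ-* b d)) (-‿distribˡ-* b (- d)))

  morphism : differences -Raw-AlmostCommutative⟶ fromCommutativeRing R
  morphism = record
    { ⟦_⟧    = ⟦_⟧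
    ; +-homo = λ (a , b) (c , d) → begin
        ⟦ (a , b) D.+ (c , d) ⟧       ≈⟨ ⟦⟧-reduce (a ℕ.+ c) (b ℕ.+ d) ⟩
        ι (a ℕ.+ c) - ι (b ℕ.+ d)     ≈⟨ +-cong (×-homo-+ 1# a c) (-‿cong (×-homo-+ 1# b d)) ⟩
        (ι a + ι c) - (ι b + ι d)     ≈⟨ +-congˡ (⁻¹-∙-comm _ _) ⟨
        (ι a + ι c) + (- ι b + - ι d) ≈⟨ interchange _ _ _ _ ⟩
        (ι a - ι b) + (ι c - ι d)     ≈⟨ +-cong (⟦⟧-difference a b) (⟦⟧-difference c d) ⟨
        ⟦ a , b ⟧ + ⟦ c , d ⟧         ∎
    ; *-homo = λ (a , b) (c , d) → begin
        ⟦ (a , b) D.* (c , d) ⟧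
          ≈⟨ ⟦⟧-reduce (a ℕ.* c ℕ.+ b ℕ.* d) (a ℕ.* d ℕ.+ b ℕ.* c) ⟩
        ι (a ℕ.* c ℕ.+ b ℕ.* d) - ι (a ℕ.* d ℕ.+ b ℕ.* c)
          ≈⟨ +-cong (ι-+-* a c b d) (-‿cong (ι-+-* a d b c)) ⟩
        (ι a * ι c + ι b * ι d) - (ι a * ι d + ι b * ι c)
          ≈⟨ difference-* (ι a) (ι b) (ι c) (ι d) ⟩
        (ι a - ι b) * (ι c - ι d)
          ≈⟨ *-cong (⟦⟧-difference a b) (⟦⟧-difference c d) ⟨
        ⟦ a , b ⟧ * ⟦ c , d ⟧ ∎
    ; -‿homo = λ (a , b) → begin
        ⟦ b , a ⟧         ≈⟨ ⟦⟧-difference b a ⟩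
        ι b - ι a         ≈⟨ +-comm _ _ ⟩
        - ι a + ι b       ≈⟨ +-congˡ (⁻¹-involutive _) ⟨
        - ι a + - - ι b   ≈⟨ ⁻¹-∙-comm _ _ ⟩
        - (ι a - ι b)     ≈⟨ -‿cong (⟦⟧-difference a b) ⟨
        - ⟦ a , b ⟧       ∎
    ; 0-homo = refl
    ; 1-homo = refl
    }
    where
    ι-+-* : ∀ a c b d → ι (a ℕ.* c ℕ.+ b ℕ.* d) ≈ ι a * ι c + ι b * ι d
    ι-+-* a c b d = trans (×-homo-+ 1# (a ℕ.* c) (b ℕ.* d)) (+-cong (×1-homo-* a c) (×1-homo-* b d))

  -- Cancellation in the solver needs coefficients whose equality can be tested, which the ring
  -- itself does not offer. Only a positive answer is given, since different integers may have the
  -- same image in the ring.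
  ⟦⟧-≟ : ∀ p q → Maybe (⟦ p ⟧ ≈ ⟦ q ⟧)
  ⟦⟧-≟ (a , b) (c , d) = Maybe.map ⟦⟧-cong (dec⇒weaklyDec ℕ._≟_ (a ℕ.+ d) (c ℕ.+ b))
    where
    ⟦⟧-cong : a ℕ.+ d ≡ c ℕ.+ b → ⟦ a , b ⟧ ≈ ⟦ c , d ⟧
    ⟦⟧-cong eq = begin
      ⟦ a , b ⟧                          ≈⟨ ⟦⟧-difference a b ⟩
      ι a - ι b                          ≈⟨ +-identityʳ _ ⟨
      (ι a - ι b) + 0#                   ≈⟨ +-congˡ (-‿inverseʳ (ι d)) ⟨
      (ι a - ι b) + (ι d - ι d)          ≈⟨ interchange _ _ _ _ ⟩
      (ι a + ι d) + (- ι b - ι d)        ≈⟨ +-congʳ (×-homo-+ 1# a d) ⟨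
      ι (a ℕ.+ d) + (- ι b - ι d)        ≡⟨ ≡.cong (λ n → ι n + (- ι b - ι d)) eq ⟩
      ι (c ℕ.+ b) + (- ι b - ι d)        ≈⟨ +-cong (×-homo-+ 1# c b) (+-comm _ _) ⟩
      (ι c + ι b) + (- ι d - ι b)        ≈⟨ interchange _ _ _ _ ⟩
      (ι c - ι d) + (ι b - ι b)          ≈⟨ +-congˡ (-‿inverseʳ (ι b)) ⟩
      (ι c - ι d) + 0#                   ≈⟨ +-identityʳ _ ⟩
      ι c - ι d                          ≈⟨ ⟦⟧-difference c d ⟨
      ⟦ c , d ⟧                          ∎

  open import Algebra.Solver.Ring differences (fromCommutativeRing R) morphism ⟦⟧-≟ public
    using (Polynomial; solve; _:=_; con; _:+_; _:*_; _:-_; :-_)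

-- Polynomial formulas for exchanging two rows.

record Weights {a} (A : Set a) : Set a where
  constructor weights
  field
    a₀ a₁ b c₊ c₋ : A

-- The formulas are stated over raw operations so that they can be read both in
-- a ring and as polynomial expressions for the ring solver.
module ExchangeFormulas {a ℓ} (S : RawRing a ℓ) where

  open RawRing S
  open Weights

  -- The first column of two consecutive rows with weights α and β; R₀ and R₁
  -- are the contributions of the other columns when the partial sum of the
  -- first column below the two rows is false and true.
  step : (α β : Weights Carrier) (R₀ R₁ : Bool → Bool → Carrier) → Bool → Bool → Bool → Carrier
  step α β R₀ R₁ false false false =
    a₀ α * (a₀ β * R₀ false false + c₊ β * R₁ false true) + c₊ α * (b β * R₁ true false)
  step α β R₀ R₁ false false true  = b α * (b β * R₁ false false)
  step α β R₀ R₁ false true  false =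
    a₀ α * (b β * R₀ false true) + c₊ α * (a₁ β * R₁ true true + c₋ β * R₀ true false)
  step α β R₀ R₁ false true  true  = b α * (a₁ β * R₁ false true + c₋ β * R₀ false false)
  step α β R₀ R₁ true  false false = b α * (a₀ β * R₀ true false + c₊ β * R₁ true true)
  step α β R₀ R₁ true  false true  =
    a₁ α * (b β * R₁ true false) + c₋ α * (a₀ β * R₀ false false + c₊ β * R₁ false true)
  step α β R₀ R₁ true  true  false = b α * (b β * R₀ true true)
  step α β R₀ R₁ true  true  true  =
    a₁ α * (a₁ β * R₁ true true + c₋ β * R₀ true false) + c₋ α * (b β * R₀ false true)

  -- The last weight makes a₀ a₁ + b² - c₊ c₋ = (x + 1 - y) a₀ b, the relation
  -- which holds for the homogeneous weights.
  inhomogeneous : (x y z : Carrier) → Weights Carrier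
  inhomogeneous x y z = weights z (x * z) 1# 1# ((x * z + - 1#) * (z + - 1#) + y * z)

  homogeneous : (x y : Carrier) → Weights Carrier
  homogeneous x y = weights 1# x 1# 1# y

  -- Two consecutive rows starting with h₁ and h₂ contribute left h₁ h₂ if the
  -- upper one is inhomogeneous and right h₁ h₂ if the lower one is. Expressing
  -- one in terms of the other needs division by y (the R-matrix); the
  -- parameter s is the quotient.
  left right : (x y z u t q s : Carrier) → Bool → Bool → Carrier
  left  x y z u t q s false false = u
  left  x y z u t q s false true  = x * q + - (y * s)
  left  x y z u t q s true  false = q + (z + - 1#) * s
  left  x y z u t q s true  true  = t
  right x y z u t q s false false = u
  right x y z u t q s false true  = z * (x * q + - (y * s)) + (z + - 1#) * s
  right x y z u t q s true  false = q
  right x y z u t q s true  true  = t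

  module Step (x y z u₀ t₀ q₀ s₀ u₁ t₁ q₁ s₁ : Carrier) where

    L₀ R₀ L₁ R₁ : Bool → Bool → Carrier
    L₀ = left  x y z u₀ t₀ q₀ s₀
    R₀ = right x y z u₀ t₀ q₀ s₀
    L₁ = left  x y z u₁ t₁ q₁ s₁
    R₁ = right x y z u₁ t₁ q₁ s₁

    ω ο : Weights Carrier
    ω = inhomogeneous x y z
    ο = homogeneous x y

    stepped : Bool → Bool → Bool → Carrier
    stepped = step ο ω R₀ R₁

    -- Obtained by solving `y * s = x * q - left false true` after one more column: all terms of the
    -- right-hand side without a factor `y` cancel, and this is what is left after removing that
    -- factor.
    s : Bool → Carrier
    s false = s₀ + - q₀
    s true  = x * (s₁ + R₁ false true) + (x * z + - 1#) * u₀

    -- `right` returns `u`, `t` and `q` unchanged for three of the four pairs of states, so their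
    -- new values can be read off from `stepped`; only `s` needs a formula of its own.
    solved : ((x y z u t q s : Carrier) → Bool → Bool → Carrier) → Bool → Bool → Bool → Carrier
    solved f v = f x y z (stepped false false v) (stepped true true v) (stepped true false v) (s v)

-- Transfer operators and the exchange of rows.

module Transfer {c ℓ} (R : CommutativeRing c ℓ) where

  open CommutativeRing R
  open IntegerCoefficientSolver R
  open import Algebra.Properties.Semiring.Exp semiring using (_^_; ^-congˡ)
  open import Algebra.Properties.CommutativeSemiring.Exp commutativeSemiring using (^-distrib-*)
  open import Relation.Binary.Reasoning.Setoid setoid

  open ExchangeFormulas rawRing
  open Weights

  RowWeights : ℕ → Set c
  RowWeights = Vec (Weights Carrier)

  -- The sum over the rows that start with partial sum h and end with partial
  -- sum true, lying below the column partial sums V; the argument of f is the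
  -- vector of column partial sums including the row.
  row : ∀ {m} → RowWeights m → Bool → Vec Bool m → (Vec Bool m → Carrier) → Carrier
  row []       false []          f = 0#
  row []       true  []          f = f []
  row (w ∷ ws) false (false ∷ V) f =
    a₀ w * row ws false V (f ∘ (false ∷_)) + c₊ w * row ws true V (f ∘ (true ∷_))
  row (w ∷ ws) false (true  ∷ V) f = b w * row ws false V (f ∘ (true ∷_))
  row (w ∷ ws) true  (false ∷ V) f = b w * row ws true V (f ∘ (false ∷_))
  row (w ∷ ws) true  (true  ∷ V) f =
    a₁ w * row ws true V (f ∘ (true ∷_)) + c₋ w * row ws false V (f ∘ (false ∷_))

  row-cong : ∀ {m} (ws : RowWeights m) h V {f g} → (∀ V′ → f V′ ≈ g V′) →
             row ws h V f ≈ row ws h V g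
  row-cong []       false []          f≈g = refl
  row-cong []       true  []          f≈g = f≈g []
  row-cong (w ∷ ws) false (false ∷ V) f≈g =
    +-cong (*-congˡ (row-cong ws false V (f≈g ∘ (false ∷_))))
           (*-congˡ (row-cong ws true V (f≈g ∘ (true ∷_))))
  row-cong (w ∷ ws) false (true  ∷ V) f≈g = *-congˡ (row-cong ws false V (f≈g ∘ (true ∷_)))
  row-cong (w ∷ ws) true  (false ∷ V) f≈g = *-congˡ (row-cong ws true V (f≈g ∘ (false ∷_)))
  row-cong (w ∷ ws) true  (true  ∷ V) f≈g =
    +-cong (*-congˡ (row-cong ws true V (f≈g ∘ (true ∷_))))
           (*-congˡ (row-cong ws false V (f≈g ∘ (false ∷_))))

  linear-* : ∀ k l w p q → w * (k * p + l * q) ≈ k * (w * p) + l * (w * q)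
  linear-* = solve 5 (λ k l w p q → w :* (k :* p :+ l :* q) := k :* (w :* p) :+ l :* (w :* q)) refl

  linear-+ : ∀ k l w w′ p q p′ q′ →
    w * (k * p + l * q) + w′ * (k * p′ + l * q′) ≈ k * (w * p + w′ * p′) + l * (w * q + w′ * q′)
  linear-+ = solve 8 (λ k l w w′ p q p′ q′ →
    w :* (k :* p :+ l :* q) :+ w′ :* (k :* p′ :+ l :* q′) :=
    k :* (w :* p :+ w′ :* p′) :+ l :* (w :* q :+ w′ :* q′)) refl

  row-linear : ∀ {m} (ws : RowWeights m) h V k l f g →
               row ws h V (λ V′ → k * f V′ + l * g V′) ≈ k * row ws h V f + l * row ws h V g
  row-linear []       false []          k l f g =
    solve 2 (λ k l → con (0 , 0) := k :* con (0 , 0) :+ l :* con (0 , 0)) refl k l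
  row-linear []       true  []          k l f g = refl
  row-linear (w ∷ ws) false (false ∷ V) k l f g =
    trans (+-cong (*-congˡ (row-linear ws false V k l _ _))
                  (*-congˡ (row-linear ws true V k l _ _)))
          (linear-+ k l _ _ _ _ _ _)
  row-linear (w ∷ ws) false (true  ∷ V) k l f g =
    trans (*-congˡ (row-linear ws false V k l _ _)) (linear-* k l _ _ _)
  row-linear (w ∷ ws) true  (false ∷ V) k l f g =
    trans (*-congˡ (row-linear ws true V k l _ _)) (linear-* k l _ _ _)
  row-linear (w ∷ ws) true  (true  ∷ V) k l f g =
    trans (+-cong (*-congˡ (row-linear ws true V k l _ _))
                  (*-congˡ (row-linear ws false V k l _ _)))
          (linear-+ k l _ _ _ _ _ _)


  row-* : ∀ {m} (ws : RowWeights m) h V k f →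
          row ws h V (λ V′ → k * f V′) ≈ k * row ws h V f
  row-* ws h V k f = begin
    row ws h V (λ V′ → k * f V′)               ≈⟨ row-cong ws h V (λ V′ → drop (f V′)) ⟩
    row ws h V (λ V′ → k * f V′ + 0# * f V′)   ≈⟨ row-linear ws h V k 0# f f ⟩
    k * row ws h V f + 0# * row ws h V f       ≈⟨ drop _ ⟨
    k * row ws h V f                           ∎
    where
    drop : ∀ r → k * r ≈ k * r + 0# * r
    drop = solve 2 (λ k r → k :* r := k :* r :+ con (0 , 0) :* r) refl k

  rows : ∀ {m} → RowWeights m → RowWeights m → Bool → Bool → Vec Bool m →
         (Vec Bool m → Carrier) → Carrier
  rows αs βs h₁ h₂ V f = row αs h₁ V (λ V′ → row βs h₂ V′ f)

  module _ {m} (α β : Weights Carrier) (αs βs : RowWeights m)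
           (V : Vec Bool m) (f : Vec Bool (suc m) → Carrier) where

    -- The first vertex of the lower row is met only inside the sum over the rest of the upper row;
    -- linearity of `row` in its continuation brings it to the front.
    rows-step : ∀ h₁ h₂ v → rows (α ∷ αs) (β ∷ βs) h₁ h₂ (v ∷ V) f ≈
      step α β (λ h₁ h₂ → rows αs βs h₁ h₂ V (f ∘ (false ∷_)))
               (λ h₁ h₂ → rows αs βs h₁ h₂ V (f ∘ (true ∷_))) h₁ h₂ v
    rows-step false false false =
      +-cong (*-congˡ (row-linear αs false V _ _ _ _)) (*-congˡ (row-* αs true V _ _))
    rows-step false false true = *-congˡ (row-* αs false V _ _)
    rows-step false true false =
      +-cong (*-congˡ (row-* αs false V _ _)) (*-congˡ (row-linear αs true V _ _ _ _))
    rows-step false true true = *-congˡ (row-linear αs false V _ _ _ _)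
    rows-step true false false = *-congˡ (row-linear αs true V _ _ _ _)
    rows-step true false true =
      +-cong (*-congˡ (row-* αs true V _ _)) (*-congˡ (row-linear αs false V _ _ _ _))
    rows-step true true false = *-congˡ (row-* αs true V _ _)
    rows-step true true true =
      +-cong (*-congˡ (row-linear αs true V _ _ _ _)) (*-congˡ (row-* αs false V _ _))

  step-cong : ∀ α β {R₀ R₁ S₀ S₁} →
              (∀ h₁ h₂ → R₀ h₁ h₂ ≈ S₀ h₁ h₂) → (∀ h₁ h₂ → R₁ h₁ h₂ ≈ S₁ h₁ h₂) →
              ∀ h₁ h₂ v → step α β R₀ R₁ h₁ h₂ v ≈ step α β S₀ S₁ h₁ h₂ v
  step-cong α β eq₀ eq₁ false false false =
    +-cong (*-congˡ (+-cong (*-congˡ (eq₀ false false)) (*-congˡ (eq₁ false true))))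
           (*-congˡ (*-congˡ (eq₁ true false)))
  step-cong α β eq₀ eq₁ false false true =
    *-congˡ (*-congˡ (eq₁ false false))
  step-cong α β eq₀ eq₁ false true false =
    +-cong (*-congˡ (*-congˡ (eq₀ false true)))
           (*-congˡ (+-cong (*-congˡ (eq₁ true true)) (*-congˡ (eq₀ true false))))
  step-cong α β eq₀ eq₁ false true true =
    *-congˡ (+-cong (*-congˡ (eq₁ false true)) (*-congˡ (eq₀ false false)))
  step-cong α β eq₀ eq₁ true false false =
    *-congˡ (+-cong (*-congˡ (eq₀ true false)) (*-congˡ (eq₁ true true)))
  step-cong α β eq₀ eq₁ true false true =
    +-cong (*-congˡ (*-congˡ (eq₁ true false)))
           (*-congˡ (+-cong (*-congˡ (eq₀ false false)) (*-congˡ (eq₁ false true))))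
  step-cong α β eq₀ eq₁ true true false =
    *-congˡ (*-congˡ (eq₀ true true))
  step-cong α β eq₀ eq₁ true true true =
    +-cong (*-congˡ (+-cong (*-congˡ (eq₁ true true)) (*-congˡ (eq₀ true false))))
           (*-congˡ (*-congˡ (eq₀ false true)))

  polynomials : ℕ → RawRing _ _
  polynomials n = record
    { Carrier = Polynomial n
    ; _≈_     = _≡_
    ; _+_     = _:+_
    ; _*_     = _:*_
    ; -_      = :-_
    ; 0#      = con (0 , 0)
    ; 1#      = con (1 , 0)
    }

  module P = ExchangeFormulas (polynomials 11)

  leftEquation rightEquation : (h₁ h₂ v : Bool) (x y z u₀ t₀ q₀ s₀ u₁ t₁ q₁ s₁ : Polynomial 11) →
                               Polynomial 11 × Polynomial 11
  leftEquation h₁ h₂ v x y z u₀ t₀ q₀ s₀ u₁ t₁ q₁ s₁ =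
    P.step ω ο L₀ L₁ h₁ h₂ v := solved P.left v h₁ h₂
    where open P.Step x y z u₀ t₀ q₀ s₀ u₁ t₁ q₁ s₁
  rightEquation h₁ h₂ v x y z u₀ t₀ q₀ s₀ u₁ t₁ q₁ s₁ =
    stepped h₁ h₂ v := solved P.right v h₁ h₂
    where open P.Step x y z u₀ t₀ q₀ s₀ u₁ t₁ q₁ s₁

  -- The Yang-Baxter equation for one column: the `left` form persists with the same new parameters
  -- as the `right` form. As `s` already stands for the quotient by `y`, every case is a polynomial
  -- identity in eleven indeterminates.
  step-left : ∀ h₁ h₂ v x y z u₀ t₀ q₀ s₀ u₁ t₁ q₁ s₁ →
              let open Step x y z u₀ t₀ q₀ s₀ u₁ t₁ q₁ s₁ in
              step ω ο L₀ L₁ h₁ h₂ v ≈ solved left v h₁ h₂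
  step-left false false false = solve 11 (leftEquation false false false) refl
  step-left false false true = solve 11 (leftEquation false false true) refl
  step-left false true false = solve 11 (leftEquation false true false) refl
  step-left false true true = solve 11 (leftEquation false true true) refl
  step-left true false false = solve 11 (leftEquation true false false) refl
  step-left true false true = solve 11 (leftEquation true false true) refl
  step-left true true false = solve 11 (leftEquation true true false) refl
  step-left true true true = solve 11 (leftEquation true true true) refl

  step-right : ∀ h₁ h₂ v x y z u₀ t₀ q₀ s₀ u₁ t₁ q₁ s₁ →
               let open Step x y z u₀ t₀ q₀ s₀ u₁ t₁ q₁ s₁ in
               step ο ω R₀ R₁ h₁ h₂ v ≈ solved right v h₁ h₂
  step-right false false v _ _ _ _ _ _ _ _ _ _ _ = refl
  step-right true  false v _ _ _ _ _ _ _ _ _ _ _ = refl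
  step-right true  true  v _ _ _ _ _ _ _ _ _ _ _ = refl
  step-right false true false = solve 11 (rightEquation false true false) refl
  step-right false true true = solve 11 (rightEquation false true true) refl

  δ : ∀ {m} → Vec Bool m → Carrier
  δ []          = 1#
  δ (false ∷ V) = 0#
  δ (true  ∷ V) = δ V

  partition : ∀ {m k} → Vec (RowWeights m) k → Vec Bool m → Carrier
  partition []         = δ
  partition (ws ∷ wss) V = row ws false V (partition wss)

  row-0 : ∀ {m} (ws : RowWeights m) h V → row ws h V (λ _ → 0#) ≈ 0#
  row-0 ws h V = begin
    row ws h V (λ _ → 0#)       ≈⟨ row-cong ws h V (λ _ → sym (zeroˡ 0#)) ⟩
    row ws h V (λ _ → 0# * 0#)  ≈⟨ row-* ws h V 0# (λ _ → 0#) ⟩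
    0# * row ws h V (λ _ → 0#)  ≈⟨ zeroˡ _ ⟩
    0#                          ∎

  -- Moving the special row from the top to the bottom.

  module Boundary (x y z₁ z₂ : Carrier) where

    ο : Weights Carrier
    ο = homogeneous x y

    ω : Weights Carrier
    ω = inhomogeneous x y z₂

    record Exchange (A B : Bool → Bool → Carrier) : Set (c ⊔ ℓ) where
      field
        u t q s : Carrier
        A≈left  : ∀ h₁ h₂ → A h₁ h₂ ≈ left  x y z₂ u t q s h₁ h₂
        B≈right : ∀ h₁ h₂ → B h₁ h₂ ≈ right x y z₂ u t q s h₁ h₂

    exchange : ∀ {m} (V : Vec Bool m) f →
               Exchange (λ h₁ h₂ → rows (replicate m ω) (replicate m ο) h₁ h₂ V f)
                        (λ h₁ h₂ → rows (replicate m ο) (replicate m ω) h₁ h₂ V f)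
    -- Without columns both rows must already be in state true, so only `t` is nonzero.
    exchange [] f = record
      { u = 0# ; t = f [] ; q = 0# ; s = 0# ; A≈left = A≈left ; B≈right = B≈right }
      where
      o : ∀ {n} → Polynomial n
      o = con (0 , 0)
      A≈left : ∀ h₁ h₂ → rows [] [] h₁ h₂ [] f ≈ left x y z₂ 0# (f []) 0# 0# h₁ h₂
      A≈left false false = refl
      A≈left false true  = solve 2 (λ x y → o := x :* o :- y :* o) refl x y
      A≈left true  false = solve 1 (λ z → o := o :+ (z :- con (1 , 0)) :* o) refl z₂
      A≈left true  true  = refl
      B≈right : ∀ h₁ h₂ → rows [] [] h₁ h₂ [] f ≈ right x y z₂ 0# (f []) 0# 0# h₁ h₂
      B≈right false false = refl
      B≈right false true  = 
        solve 3 (λ x y z → o := z :* (x :* o :- y :* o) :+ (z :- con (1 , 0)) :* o) refl x y z₂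
      B≈right true  false = refl
      B≈right true  true  = refl
    exchange (v ∷ V) f = record
      { u = stepped false false v
      ; t = stepped true true v
      ; q = stepped true false v
      ; s = S v
      ; A≈left  = λ h₁ h₂ → trans (rows-step ω ο _ _ V f h₁ h₂ v)
                    (trans (step-cong ω ο E₀.A≈left E₁.A≈left h₁ h₂ v)
                           (step-left h₁ h₂ v x y z₂ E₀.u E₀.t E₀.q E₀.s E₁.u E₁.t E₁.q E₁.s))
      ; B≈right = λ h₁ h₂ → trans (rows-step ο ω _ _ V f h₁ h₂ v)
                    (trans (step-cong ο ω E₀.B≈right E₁.B≈right h₁ h₂ v)
                           (step-right h₁ h₂ v x y z₂ E₀.u E₀.t E₀.q E₀.s E₁.u E₁.t E₁.q E₁.s))
      }
      where
      module E₀ = Exchange (exchange V (f ∘ (false ∷_)))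
      module E₁ = Exchange (exchange V (f ∘ (true ∷_)))
      open Step x y z₂ E₀.u E₀.t E₀.q E₀.s E₁.u E₁.t E₁.q E₁.s hiding (ο; ω) renaming (s to S)

    -- The weights a₁ and c₋ never occur in the first column, since a row
    -- starts with partial sum false.
    firstColumn : Carrier → Carrier → Carrier → Weights Carrier
    firstColumn a b c = weights a 0# b c 0#

    edge : ∀ {m} → RowWeights (suc m)
    edge {m} = firstColumn z₁ 1# 1# ∷ replicate m ο

    special : ∀ {m} → Carrier → Carrier → Carrier → RowWeights (suc m)
    special {m} a b c = firstColumn a b c ∷ replicate m ω

    -- The weights a₀ and b of the vertex where the lines of z₁ and z₂ cross
    -- that, together with c₊ = y, make the special row commute with the edge rows.
    a∗ b∗ : Carrier
    a∗ = y * z₁ * z₂ - (z₁ - 1#) * (z₂ - 1#)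
    b∗ = y - x * ((z₁ - 1#) * (z₂ - 1#))

    -- Both rows enter the first column with partial sum false. The remaining columns are
    -- homogeneous for one row and inhomogeneous for the other, so `exchange` expresses both orders
    -- by the same parameters and one vertex pair per row order is left to compare.
    edge-exchange : ∀ {m} (V : Vec Bool (suc m)) f →
      rows (special a∗ b∗ y) edge false false V f ≈ rows edge (special a∗ b∗ y) false false V f
    edge-exchange (v ∷ V) f = begin
      rows (special a∗ b∗ y) edge false false (v ∷ V) f
        ≈⟨ rows-step κ ε _ _ V f false false v ⟩
      step κ ε _ _ false false v
        ≈⟨ step-cong κ ε E₀.A≈left E₁.A≈left false false v ⟩
      step κ ε (left x y z₂ E₀.u E₀.t E₀.q E₀.s) (left x y z₂ E₁.u E₁.t E₁.q E₁.s) false false v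
        ≈⟨ commute v E₀.u E₁.u E₁.q E₁.s ⟩
      step ε κ (right x y z₂ E₀.u E₀.t E₀.q E₀.s) (right x y z₂ E₁.u E₁.t E₁.q E₁.s) false false v
        ≈⟨ step-cong ε κ E₀.B≈right E₁.B≈right false false v ⟨
      step ε κ _ _ false false v
        ≈⟨ rows-step ε κ _ _ V f false false v ⟨
      rows edge (special a∗ b∗ y) false false (v ∷ V) f ∎
      where
      κ ε : Weights Carrier
      κ = firstColumn a∗ b∗ y
      ε = firstColumn z₁ 1# 1#
      module E₀ = Exchange (exchange V (f ∘ (false ∷_)))
      module E₁ = Exchange (exchange V (f ∘ (true ∷_)))
      commute : ∀ v u₀ u₁ q₁ s₁ {t₀ q₀ s₀ t₁} →
        step κ ε (left x y z₂ u₀ t₀ q₀ s₀) (left x y z₂ u₁ t₁ q₁ s₁) false false v ≈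
        step ε κ (right x y z₂ u₀ t₀ q₀ s₀) (right x y z₂ u₁ t₁ q₁ s₁) false false v
      commute true  u₀ u₁ q₁ s₁ =
          solve 2 (λ b u → b :* (con (1 , 0) :* u) := con (1 , 0) :* (b :* u)) refl b∗ u₁
      -- This case determines the crossing weights: the coefficients of `s₁` on both sides agree,
      -- after removing a factor `y`, for `a = a∗`, and then those of `q₁` agree for `b = b∗`.
      commute false u₀ u₁ q₁ s₁ =
        solve 8 (λ x y z₁ z₂ u₀ u₁ q₁ s₁ →
          let o = con (1 , 0)
              a = y :* z₁ :* z₂ :- (z₁ :- o) :* (z₂ :- o)
              b = y :- x :* ((z₁ :- o) :* (z₂ :- o))
              p = x :* q₁ :- y :* s₁
              w = z₂ :- o
          in a :* (z₁ :* u₀ :+ o :* p) :+ y :* (o :* (q₁ :+ w :* s₁))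
             := z₁ :* (a :* u₀ :+ y :* (z₂ :* p :+ w :* s₁)) :+ o :* (b :* q₁))
          refl x y z₁ z₂ u₀ u₁ q₁ s₁

    rowInserted : ∀ {m} k → RowWeights (suc m) → Vec (RowWeights (suc m)) (suc k)
    rowInserted zero    ws = ws ∷ []
    rowInserted (suc k) ws = edge ∷ rowInserted k ws

    -- `edge-exchange` holds for every continuation, so the special row passes one edge row at a
    -- time whatever lies below.
    slide : ∀ {m} k (V : Vec Bool (suc m)) → let ws = special a∗ b∗ y in
            partition (ws ∷ replicate k edge) V ≈ partition (rowInserted k ws) V
    slide zero    V = refl
    slide (suc k) V = trans (edge-exchange V _) (row-cong edge false V (slide k))

    bulk : ∀ m k → Vec Bool m → Carrier
    bulk m k = partition (replicate k (replicate m ο))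

    partition-edge-true : ∀ {m} k (V : Vec Bool m) →
                          partition (replicate k edge) (true ∷ V) ≈ bulk m k V
    partition-edge-true zero    V = refl
    partition-edge-true (suc k) V =
      trans (*-identityˡ _) (row-cong (replicate _ ο) false V (partition-edge-true k))

    ωs : ∀ {m} → RowWeights m
    ωs = replicate _ ω

    οs : ∀ {m} → RowWeights m
    οs = replicate _ ο

    row-true-empty : ∀ m f → row ωs true (replicate m false) f ≈ f (replicate m false)
    row-true-empty zero    f = refl
    row-true-empty (suc m) f = trans (*-identityˡ _) (row-true-empty m (f ∘ (false ∷_)))

    -- For `δ` to be nonzero, every column must end in true. A row already in state true then cannot
    -- use `b₁₀` or `c₋`, which end a column in false, so it consists of `a₁` only.
    row-true-full : ∀ m (V : Vec Bool m) → row ωs true V δ ≈ (x * z₂) ^ m * δ V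
    row-true-full zero    []          = sym (*-identityˡ _)
    row-true-full (suc m) (false ∷ V) = begin
      1# * row ωs true V (λ _ → 0#) ≈⟨ *-congˡ (row-0 ωs true V) ⟩
      1# * 0#                       ≈⟨ trans (zeroʳ _) (sym (zeroʳ _)) ⟩
      (x * z₂) ^ suc m * 0#         ∎
    row-true-full (suc m) (true  ∷ V) = begin
      x * z₂ * row ωs true V δ + _ * row ωs false V (λ _ → 0#)
        ≈⟨ +-cong (*-congˡ (row-true-full m V)) (*-congˡ (row-0 ωs false V)) ⟩
      x * z₂ * ((x * z₂) ^ m * δ V) + _ * 0#
        ≈⟨ trans (+-congˡ (zeroʳ _)) (+-identityʳ _) ⟩
      x * z₂ * ((x * z₂) ^ m * δ V)
        ≈⟨ *-assoc _ _ _ ⟨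
      (x * z₂) ^ suc m * δ V ∎

    X : ℕ → ℕ → Carrier
    X m k = row ωs false (replicate m false)
                (partition (replicate k edge) ∘ (false ∷_))

    -- Under empty columns the corner vertex is `a₀` or `c₊`. In the second case the row continues
    -- with `b₁₀`, of weight 1, and the first column is finished, so a homogeneous system with one
    -- column less remains.
    partition-top : ∀ m k a b c →
      partition (special a b c ∷ replicate k edge) (replicate (suc m) false) ≈
      a * X m k + c * bulk m k (replicate m false)
    partition-top m k a b c =
      +-congˡ (*-congˡ (trans (row-true-empty m _) (partition-edge-true k (replicate m false))))

    -- With these corner weights it counts exactly the configurations whose first column is complete
    -- before the last row is reached.
    Y : ∀ {m} → ℕ → Vec Bool (suc m) → Carrier
    Y k = partition (rowInserted k (special 0# 1# 0#))

    partition-bottom-true : ∀ {m} k a b c (V : Vec Bool m) →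
      partition (rowInserted k (special a b c)) (true ∷ V) ≈ b * Y k (true ∷ V)
    partition-bottom-true zero    a b c V = *-congˡ (sym (*-identityˡ _))
    partition-bottom-true (suc k) a b c V = begin
      1# * row οs false V (partition (rowInserted k (special a b c)) ∘ (true ∷_))
        ≈⟨ *-congˡ (row-cong οs false V (partition-bottom-true k a b c)) ⟩
      1# * row οs false V (λ V′ → b * Y k (true ∷ V′))
        ≈⟨ *-congˡ (row-* οs false V b _) ⟩
      1# * (b * row οs false V (Y k ∘ (true ∷_)))
        ≈⟨ swap _ _ _ ⟩
      b * (1# * row οs false V (Y k ∘ (true ∷_))) ∎
      where
      swap : ∀ p q r → p * (q * r) ≈ q * (p * r)
      swap = solve 3 (λ p q r → p :* (q :* r) := q :* (p :* r)) refl

    -- If the first column is still false at the last row, the corner must be `c₊`: the `k` edge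
    -- rows above contribute `z₁` each and the rest of the last row is all `a₁`. Otherwise the
    -- corner is `b`, and its weight factors out.
    partition-bottom-false : ∀ {m} k a b c (V : Vec Bool m) →
      partition (rowInserted k (special a b c)) (false ∷ V) ≈
      c * (z₁ ^ k * (x * z₂) ^ m) * bulk m k V + b * Y k (false ∷ V)
    partition-bottom-false {m} zero a b c V = begin
      a * row ωs false V (λ _ → 0#) + c * row ωs true V δ
        ≈⟨ +-cong (*-congˡ (row-0 ωs false V)) (*-congˡ (row-true-full m V)) ⟩
      a * 0# + c * ((x * z₂) ^ m * δ V)
        ≈⟨ arrange a b c ((x * z₂) ^ m) (δ V) _ ⟩
      c * (1# * (x * z₂) ^ m) * δ V + b * (0# * 0# + 0# * _)
        ≈⟨ +-congˡ (*-congˡ (+-congʳ (*-congˡ (row-0 ωs false V)))) ⟨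
      c * (1# * (x * z₂) ^ m) * δ V + b * (0# * row ωs false V (λ _ → 0#) + 0# * row ωs true V δ) ∎
      where
      arrange : ∀ a b c p d r → a * 0# + c * (p * d) ≈ c * (1# * p) * d + b * (0# * 0# + 0# * r)
      arrange = solve 6 (λ a b c p d r → let o = con (0 , 0) in
        a :* o :+ c :* (p :* d) := c :* (con (1 , 0) :* p) :* d :+ b :* (o :* o :+ o :* r)) refl
    partition-bottom-false {m} (suc k) a b c V = begin
      z₁ * row οs false V (partition (rowInserted k ws) ∘ (false ∷_))
        + 1# * row οs true V (partition (rowInserted k ws) ∘ (true ∷_))
        ≈⟨ +-cong (*-congˡ (row-cong οs false V (partition-bottom-false k a b c)))
                  (*-congˡ (row-cong οs true V (partition-bottom-true k a b c))) ⟩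
      z₁ * row οs false V (λ V′ → c * (z₁ ^ k * (x * z₂) ^ m) * bulk m k V′ + b * Y k (false ∷ V′))
        + 1# * row οs true V (λ V′ → b * Y k (true ∷ V′))
        ≈⟨ +-cong (*-congˡ (row-linear οs false V _ b _ _))
                  (*-congˡ (row-* οs true V b _)) ⟩
      z₁ * (c * (z₁ ^ k * (x * z₂) ^ m) * bulk m (suc k) V + b * row οs false V (Y k ∘ (false ∷_)))
        + 1# * (b * row οs true V (Y k ∘ (true ∷_)))
        ≈⟨ arrange z₁ b c (z₁ ^ k) ((x * z₂) ^ m) _ _ _ ⟩
      c * (z₁ ^ suc k * (x * z₂) ^ m) * bulk m (suc k) V
        + b * (z₁ * row οs false V (Y k ∘ (false ∷_)) + 1# * row οs true V (Y k ∘ (true ∷_))) ∎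
      where
      ws = special a b c
      arrange : ∀ z b c p q d r t →
        z * (c * (p * q) * d + b * r) + 1# * (b * t) ≈ c * (z * p * q) * d + b * (z * r + 1# * t)
      arrange = solve 8 (λ z b c p q d r t → let o = con (1 , 0) in
        z :* (c :* (p :* q) :* d :+ b :* r) :+ o :* (b :* t) :=
        c :* (z :* p :* q) :* d :+ b :* (z :* r :+ o :* t)) refl

    boundary-relation : ∀ m →
      let Top    = partition (special (z₁ * z₂) 1# 1# ∷ replicate m edge) (replicate (suc m) false)
          Bottom = partition (rowInserted m (special 1# 1# 1#)) (replicate (suc m) false)
      in ((z₁ - 1#) * (z₂ - 1#) - y * z₁ * z₂) * Top
           - (x * ((z₁ - 1#) * (z₂ - 1#)) - y) * (z₁ * z₂) * Bottom
         ≈ (z₁ - 1#) * (z₂ - 1#) * (1# - (x * z₁ * z₂) ^ suc m) * bulk m m (replicate m false)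
    boundary-relation m = begin
      (q - y * z₁ * z₂) * Top - (x * q - y) * (z₁ * z₂) * Bottom
        ≈⟨ +-cong (*-congˡ (partition-top m m (z₁ * z₂) 1# 1#))
                  (-‿cong (*-congˡ (partition-bottom-false m 1# 1# 1# O))) ⟩
      (q - y * z₁ * z₂) * (z₁ * z₂ * X m m + 1# * N)
        - (x * q - y) * (z₁ * z₂) * (1# * P * N + 1# * Y m (false ∷ O))
        -- `y * N` is added and subtracted to complete `a∗ * X m m` to the left side of `exchanged`.
        ≈⟨ arrange₁ x y z₁ z₂ (X m m) (Y m (false ∷ O)) N P ⟩
      (q - y * z₁ * z₂) * N
        + z₁ * z₂ * (b∗ * P * N + y * N + b∗ * Y m (false ∷ O) - (a∗ * X m m + y * N))
        ≈⟨ +-congˡ (*-congˡ (+-congˡ (-‿cong exchanged))) ⟩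
      (q - y * z₁ * z₂) * N
        + z₁ * z₂ * (b∗ * P * N + y * N + b∗ * Y m (false ∷ O) - (y * P * N + b∗ * Y m (false ∷ O)))
        ≈⟨ arrange₂ x y z₁ z₂ (Y m (false ∷ O)) N P ⟩
      q * (1# - x * z₁ * z₂ * P) * N
        ≈⟨ *-congʳ (*-congˡ (+-congˡ (-‿cong (*-congˡ power)))) ⟩
      q * (1# - (x * z₁ * z₂) ^ suc m) * N ∎
      where
      O = replicate m false
      q = (z₁ - 1#) * (z₂ - 1#)
      N = bulk m m O
      P = z₁ ^ m * (x * z₂) ^ m
      Top    = partition (special (z₁ * z₂) 1# 1# ∷ replicate m edge) (replicate (suc m) false)
      Bottom = partition (rowInserted m (special 1# 1# 1#)) (replicate (suc m) false)
      exchanged : a∗ * X m m + y * N ≈ y * P * N + b∗ * Y m (false ∷ O)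
      exchanged = begin
        a∗ * X m m + y * N                 ≈⟨ partition-top m m a∗ b∗ y ⟨
        partition (special a∗ b∗ y ∷ replicate m edge) (replicate (suc m) false)
                                           ≈⟨ slide m (replicate (suc m) false) ⟩
        partition (rowInserted m (special a∗ b∗ y)) (replicate (suc m) false)
                                           ≈⟨ partition-bottom-false m a∗ b∗ y O ⟩
        y * P * N + b∗ * Y m (false ∷ O)   ∎
      power : P ≈ (x * z₁ * z₂) ^ m
      power = trans (sym (^-distrib-* z₁ (x * z₂) m))
                    (^-congˡ m (solve 3 (λ x z₁ z₂ → z₁ :* (x :* z₂) := x :* z₁ :* z₂)
                                      refl x z₁ z₂))
      arrange₁ : ∀ x y z₁ z₂ X Y N P → let q = (z₁ - 1#) * (z₂ - 1#) in
        (q - y * z₁ * z₂) * (z₁ * z₂ * X + 1# * N)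
          - (x * q - y) * (z₁ * z₂) * (1# * P * N + 1# * Y) ≈
        (q - y * z₁ * z₂) * N
          + z₁ * z₂ * ((y - x * q) * P * N + y * N + (y - x * q) * Y - ((y * z₁ * z₂ - q) * X + y * N))
      arrange₁ = solve 8 (λ x y z₁ z₂ X Y N P → let o = con (1 , 0); q = (z₁ :- o) :* (z₂ :- o) in
        (q :- y :* z₁ :* z₂) :* (z₁ :* z₂ :* X :+ o :* N)
          :- (x :* q :- y) :* (z₁ :* z₂) :* (o :* P :* N :+ o :* Y) :=
        (q :- y :* z₁ :* z₂) :* N
          :+ z₁ :* z₂ :* ((y :- x :* q) :* P :* N :+ y :* N :+ (y :- x :* q) :* Y
                           :- ((y :* z₁ :* z₂ :- q) :* X :+ y :* N))) refl
      arrange₂ : ∀ x y z₁ z₂ Y N P → let q = (z₁ - 1#) * (z₂ - 1#) in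
        (q - y * z₁ * z₂) * N
          + z₁ * z₂ * ((y - x * q) * P * N + y * N + (y - x * q) * Y - (y * P * N + (y - x * q) * Y)) ≈
        q * (1# - x * z₁ * z₂ * P) * N
      arrange₂ = solve 7 (λ x y z₁ z₂ Y N P → let o = con (1 , 0); q = (z₁ :- o) :* (z₂ :- o) in
        (q :- y :* z₁ :* z₂) :* N
          :+ z₁ :* z₂ :* ((y :- x :* q) :* P :* N :+ y :* N :+ (y :- x :* q) :* Y
                           :- (y :* P :* N :+ (y :- x :* q) :* Y)) :=
        q :* (o :- x :* z₁ :* z₂ :* P) :* N) refl

-- Alternating sign matrices as six-vertex configurations.

module Configurations where

  open import Algebra.Properties.AbelianGroup ℤ.+-0-abelianGroup
    using () renaming (∙-cancelˡ to +-cancelˡ)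
  open import Algebra.Properties.Semiring.Sum ℤ.+-*-semiring
    using (sum; sum-syntax; sum-cong-≗; sum-replicate-zero; ∑-comm; *-distribˡ-sum; *-distribʳ-sum)
  open ≡ using (refl; module ≡-Reasoning)

  nonzeros : ∀ {n} → Vec ℤ n → List ℤ
  nonzeros v = List.filter (¬? ∘ (ℤ._≟ 0ℤ)) (toList v)

  Opposite : ℤ → ℤ → Set
  Opposite a b = a ≡ ℤ.- b

  -- The end of a line in which the partial sum so far is h.
  data Line : ∀ {n} → Bool → Vec ℤ n → Set where
    []   : Line true []
    zero : ∀ {n h} {v : Vec ℤ n} → Line h v → Line h (0ℤ ∷ v)
    up   : ∀ {n} {v : Vec ℤ n} → Line true v → Line false (1ℤ ∷ v)
    down : ∀ {n} {v : Vec ℤ n} → Line false v → Line true (-1ℤ ∷ v)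

  -- The last nonzero entry before the partial sum h (at the start of a line, one may pretend it was -1).
  lastNonzero : Bool → ℤ
  lastNonzero false = -1ℤ
  lastNonzero true  = 1ℤ

  remaining : Bool → ℤ
  remaining false = 1ℤ
  remaining true  = 0ℤ

  Line⇒entries : ∀ {n h} {v : Vec ℤ n} → Line h v → All (_∈ entries) v
  Line⇒entries []       = []
  Line⇒entries (zero l) = here refl ∷ Line⇒entries l
  Line⇒entries (up l)   = there (here refl) ∷ Line⇒entries l
  Line⇒entries (down l) = there (there (here refl)) ∷ Line⇒entries l

  Line⇒sum : ∀ {n h} {v : Vec ℤ n} → Line h v → sum (lookup v) ≡ remaining h
  Line⇒sum []       = refl
  Line⇒sum (zero l) = ≡.trans (ℤ.+-identityˡ _) (Line⇒sum l)
  Line⇒sum (up l)   = cong (ℤ._+_ 1ℤ) (Line⇒sum l)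
  Line⇒sum (down l) = cong (ℤ._+_ -1ℤ) (Line⇒sum l)

  Line⇒Linked : ∀ {n h} {v : Vec ℤ n} → Line h v → Linked Opposite (lastNonzero h ∷ nonzeros v)
  Line⇒Linked []       = [-]
  Line⇒Linked (zero l) = Line⇒Linked l
  Line⇒Linked (up l)   = refl ∷ Line⇒Linked l
  Line⇒Linked (down l) = refl ∷ Line⇒Linked l

  Line⇒IsASMLine : ∀ {n} {v : Vec ℤ n} → Line false v → IsASMLine v
  Line⇒IsASMLine l = tail (Line⇒Linked l) , Line⇒sum l
    where
    tail : ∀ {x xs} → Linked Opposite (x ∷ xs) → Linked Opposite xs
    tail [-]     = []
    tail (_ ∷ l) = l

  Linked⇒Line : ∀ {n} h {v : Vec ℤ n} → All (_∈ entries) v →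
                Linked Opposite (lastNonzero h ∷ nonzeros v) →
                sum (lookup v) ≡ remaining h → Line h v
  Linked⇒Line true  []                              l s = []
  Linked⇒Line h     (here refl ∷ e)                 l s =
    zero (Linked⇒Line h e l (≡.trans (≡.sym (ℤ.+-identityˡ _)) s))
  Linked⇒Line false (there (here refl) ∷ e)         (_ ∷ l) s =
    up (Linked⇒Line true e l (+-cancelˡ 1ℤ _ _ s))
  Linked⇒Line true  (there (there (here refl)) ∷ e) (_ ∷ l) s =
    down (Linked⇒Line false e l (+-cancelˡ -1ℤ _ _ s))
  Linked⇒Line false (there (there (here refl)) ∷ e) (() ∷ l) s
  Linked⇒Line true  (there (here refl) ∷ e)         (() ∷ l) s

  -- This excludes a line whose first nonzero entry is -1: the entries after it would sum to 0 or 1,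
  -- and the whole line to -1 or 0 instead of 1.
  Linked⇒sum : ∀ {n} h {v : Vec ℤ n} → All (_∈ entries) v →
               Linked Opposite (lastNonzero h ∷ nonzeros v) →
               sum (lookup v) ≡ 0ℤ ⊎ sum (lookup v) ≡ ℤ.- lastNonzero h
  Linked⇒sum h     []                              l = inj₁ refl
  Linked⇒sum h {0ℤ ∷ v} (here refl ∷ e)            l
    rewrite ℤ.+-identityˡ (sum (lookup v)) = Linked⇒sum h e l
  Linked⇒sum false (there (here refl) ∷ e)         (_ ∷ l) with Linked⇒sum true e l
  ... | inj₁ s = inj₂ (cong (ℤ._+_ 1ℤ) s)
  ... | inj₂ s = inj₁ (cong (ℤ._+_ 1ℤ) s)
  Linked⇒sum true  (there (there (here refl)) ∷ e) (_ ∷ l) with Linked⇒sum false e l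
  ... | inj₁ s = inj₂ (cong (ℤ._+_ -1ℤ) s)
  ... | inj₂ s = inj₁ (cong (ℤ._+_ -1ℤ) s)
  Linked⇒sum false (there (there (here refl)) ∷ e) (() ∷ l)
  Linked⇒sum true  (there (here refl) ∷ e)         (() ∷ l)

  IsASMLine⇒Line : ∀ {n} {v : Vec ℤ n} → All (_∈ entries) v → IsASMLine v → Line false v
  IsASMLine⇒Line (here refl ∷ e)                 (l , s) =
    zero (IsASMLine⇒Line e (l , ≡.trans (≡.sym (ℤ.+-identityˡ _)) s))
  IsASMLine⇒Line (there (here refl) ∷ e)         (l , s) =
    up (Linked⇒Line true e l (+-cancelˡ 1ℤ _ _ s))
  IsASMLine⇒Line {v = _ ∷ v} (there (there (here refl)) ∷ e) (l , s)
    with sum (lookup v) | Linked⇒sum false e l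
  ... | _ | inj₁ refl = case s of λ ()
  ... | _ | inj₂ refl = case s of λ ()

  -- In Vertex h v e h′ v′, the states h and v are the partial sums to the left
  -- of and above an entry e, and h′ and v′ are those including e.
  data Vertex : Bool → Bool → ℤ → Bool → Bool → Set where
    a₀  : Vertex false false 0ℤ  false false
    b₀₁ : Vertex false true  0ℤ  false true
    b₁₀ : Vertex true  false 0ℤ  true  false
    a₁  : Vertex true  true  0ℤ  true  true
    c₊  : Vertex false false 1ℤ  true  true
    c₋  : Vertex true  true  -1ℤ false false

  data Row : ∀ {n} → Bool → Vec Bool n → Vec ℤ n → Vec Bool n → Set where
    []  : Row true [] [] []
    _∷_ : ∀ {n h v e h′ v′} {V V′ : Vec Bool n} {r} →
          Vertex h v e h′ v′ → Row h′ V r V′ → Row h (v ∷ V) (e ∷ r) (v′ ∷ V′)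

  data Config {n} : ∀ {k} → Vec Bool n → Vec (Vec ℤ n) k → Set where
    []  : ∀ {V} → All (_≡ true) V → Config V []
    _∷_ : ∀ {k V V′ r} {A : Vec (Vec ℤ n) k} → Row false V r V′ → Config V′ A → Config V (r ∷ A)

  Vertex-horizontal : ∀ {h v e h′ v′ n} {r : Vec ℤ n} →
                      Vertex h v e h′ v′ → Line h′ r → Line h (e ∷ r)
  Vertex-horizontal a₀  l = zero l
  Vertex-horizontal b₀₁ l = zero l
  Vertex-horizontal b₁₀ l = zero l
  Vertex-horizontal a₁  l = zero l
  Vertex-horizontal c₊  l = up l
  Vertex-horizontal c₋  l = down l

  Vertex-vertical : ∀ {h v e h′ v′ n} {c : Vec ℤ n} →
                    Vertex h v e h′ v′ → Line v′ c → Line v (e ∷ c)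
  Vertex-vertical a₀  l = zero l
  Vertex-vertical b₀₁ l = zero l
  Vertex-vertical b₁₀ l = zero l
  Vertex-vertical a₁  l = zero l
  Vertex-vertical c₊  l = up l
  Vertex-vertical c₋  l = down l

  crossing : ∀ {h v e m n} {r : Vec ℤ m} {c : Vec ℤ n} → Line h (e ∷ r) → Line v (e ∷ c) →
             ∃₂ λ h′ v′ → Vertex h v e h′ v′ × Line h′ r × Line v′ c
  crossing {false} {false} (zero l) (zero m) = _ , _ , a₀  , l , m
  crossing {false} {true}  (zero l) (zero m) = _ , _ , b₀₁ , l , m
  crossing {true}  {false} (zero l) (zero m) = _ , _ , b₁₀ , l , m
  crossing {true}  {true}  (zero l) (zero m) = _ , _ , a₁  , l , m
  crossing (up l)   (up m)   = _ , _ , c₊ , l , m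
  crossing (down l) (down m) = _ , _ , c₋ , l , m

  Row⇒Line : ∀ {n h} {V V′ : Vec Bool n} {r} → Row h V r V′ → Line h r
  Row⇒Line []      = []
  Row⇒Line (t ∷ d) = Vertex-horizontal t (Row⇒Line d)

  Row⇒columns : ∀ {n h k} {V V′ : Vec Bool n} {r} → Row h V r V′ → ∀ i {c : Vec ℤ k} →
                Line (lookup V′ i) c → Line (lookup V i) (lookup r i ∷ c)
  Row⇒columns (t ∷ d) zero    l = Vertex-vertical t l
  Row⇒columns (t ∷ d) (suc i) l = Row⇒columns d i l

  Lines⇒Row : ∀ {n h k} {V : Vec Bool n} {r} (c : Fin n → Vec ℤ k) →
              Line h r → (∀ i → Line (lookup V i) (lookup r i ∷ c i)) →
              ∃ λ V′ → Row h V r V′ × (∀ i → Line (lookup V′ i) (c i))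
  Lines⇒Row {V = []}    {[]}    c [] ls = [] , [] , λ ()
  Lines⇒Row {V = v ∷ V} {e ∷ r} c l  ls =
    let _ , v′ , t , l′ , m = crossing l (ls zero)
        V′ , d , ms         = Lines⇒Row {V = V} (c ∘ suc) l′ (ls ∘ suc)
    in v′ ∷ V′ , t ∷ d , λ { zero → m ; (suc i) → ms i }

  module _ {a} {A : Set a} where

    -- This is the form to which `transpose` unfolds on a nonempty list of rows.
    prependColumn : ∀ {m n} → Vec A n → Vec (Vec A m) n → Vec (Vec A (suc m)) n
    prependColumn {n = n} r T = (replicate n _∷_ Vec.⊛ r) Vec.⊛ T

    lookup-prependColumn : ∀ {m n} (r : Vec A n) (T : Vec (Vec A m) n) i →
                           lookup (prependColumn r T) i ≡ lookup r i ∷ lookup T i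
    lookup-prependColumn (e ∷ r) (c ∷ T) zero    = refl
    lookup-prependColumn (e ∷ r) (c ∷ T) (suc i) = lookup-prependColumn r T i

    lookup-transpose-∷ : ∀ {m n} (r : Vec A n) (M : Vec (Vec A n) m) i →
                         lookup (transpose (r ∷ M)) i ≡ lookup r i ∷ lookup (transpose M) i
    lookup-transpose-∷ r M = lookup-prependColumn r (transpose M)

    lookup-transpose : ∀ {m n} (M : Vec (Vec A n) m) i j →
                       lookup (lookup (transpose M) i) j ≡ lookup (lookup M j) i
    lookup-transpose (r ∷ M) i j rewrite lookup-transpose-∷ r M i with j
    ... | zero  = refl
    ... | suc j = lookup-transpose M i j

    lookup-ext : ∀ {n} {u v : Vec A n} → (∀ i → lookup u i ≡ lookup v i) → u ≡ v
    lookup-ext {u = u} {v} eq = begin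
      u                          ≡⟨ Vec.tabulate∘lookup u ⟨
      Vec.tabulate (lookup u)    ≡⟨ Vec.tabulate-cong eq ⟩
      Vec.tabulate (lookup v)    ≡⟨ Vec.tabulate∘lookup v ⟩
      v                          ∎
      where open ≡-Reasoning

  transpose-involutive : ∀ {a} {A : Set a} {m n} (M : Vec (Vec A n) m) → transpose (transpose M) ≡ M
  transpose-involutive M = lookup-ext λ i → lookup-ext λ j →
    ≡.trans (lookup-transpose (transpose M) i j) (lookup-transpose M j i)

  Config⇒rows : ∀ {n k V} {A : Vec (Vec ℤ n) k} → Config V A → All (Line false) A
  Config⇒rows ([] _)  = []
  Config⇒rows (d ∷ D) = Row⇒Line d ∷ Config⇒rows D

  Config⇒columns : ∀ {n k V} {A : Vec (Vec ℤ n) k} → Config V A →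
                   ∀ i → Line (lookup V i) (lookup (transpose A) i)
  Config⇒columns {n} ([] full) i
    rewrite Vec.lookup-replicate {n = n} i (Vec.[] {A = ℤ}) | lookup⁺ full i = []
  Config⇒columns {A = r ∷ A} (d ∷ D) i
    rewrite lookup-transpose-∷ r A i = Row⇒columns d i (Config⇒columns D i)

  Lines⇒Config : ∀ {n k V} {A : Vec (Vec ℤ n) k} → All (Line false) A →
                 (∀ i → Line (lookup V i) (lookup (transpose A) i)) → Config V A
  Lines⇒Config {n} {V = V} [] ls = [] (lookup⁻ λ i →
    empty (subst (Line (lookup V i)) (Vec.lookup-replicate i Vec.[]) (ls i)))
    where
    empty : ∀ {h} → Line h [] → h ≡ true
    empty [] = refl
  Lines⇒Config {V = V} {r ∷ A} (l ∷ rs) ls =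
    let V′ , d , ms = Lines⇒Row (lookup (transpose A)) l λ i →
                        subst (Line (lookup V i)) (lookup-transpose-∷ r A i) (ls i)
    in d ∷ Lines⇒Config rs ms

  empty : ∀ n → Vec Bool n
  empty n = replicate n false

  Config⇒IsASM : ∀ {n} {A : Matrix n} → Config (empty n) A → IsASM A
  Config⇒IsASM {n} {A} D =
    All.map Line⇒entries (Config⇒rows D) ,
    All.map Line⇒IsASMLine (Config⇒rows D) ,
    lookup⁻ λ i → Line⇒IsASMLine
      (subst (λ h → Line h (lookup (transpose A) i)) (Vec.lookup-replicate i false) (Config⇒columns D i))

  transpose-entries : ∀ {m n} {A : Vec (Vec ℤ n) m} →
                      All (All (_∈ entries)) A → All (All (_∈ entries)) (transpose A)
  transpose-entries {A = A} e = lookup⁻ λ i → lookup⁻ λ j →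
    subst (_∈ entries) (≡.sym (lookup-transpose A i j)) (lookup⁺ (lookup⁺ e j) i)

  IsASM⇒Config : ∀ {n} {A : Matrix n} → IsASM A → Config (empty n) A
  IsASM⇒Config {n} {A} (e , rows , columns) =
    Lines⇒Config (All.map (λ (e , l) → IsASMLine⇒Line e l) (All.zip (e , rows))) λ i →
      subst (λ h → Line h (lookup (transpose A) i)) (≡.sym (Vec.lookup-replicate i false))
            (IsASMLine⇒Line (lookup⁺ (transpose-entries e) i) (lookup⁺ columns i))

  transpose-IsASM : ∀ {n} {A : Matrix n} → IsASM A → IsASM (transpose A)
  transpose-IsASM {A = A} (e , rows , columns) =
    transpose-entries e , columns , subst (All IsASMLine) (≡.sym (transpose-involutive A)) rows

  -- Statistics of matrices as numbers of vertices.

  Statistic : Set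
  Statistic = ∀ {h v e h′ v′} → Vertex h v e h′ v′ → ℕ

  #a₀ #a₁ #c₋ : Statistic
  #a₀ a₀ = 1
  #a₀ _  = 0
  #a₁ a₁ = 1
  #a₁ _  = 0
  #c₋ c₋ = 1
  #c₋ _  = 0

  rowTotal : Statistic → ∀ {n h V r V′} → Row {n} h V r V′ → ℕ
  rowTotal # []      = 0
  rowTotal # (t ∷ d) = # t ℕ.+ rowTotal # d

  configTotal : Statistic → ∀ {n k V A} → Config {n} {k} V A → ℕ
  configTotal # ([] _)  = 0
  configTotal # (d ∷ D) = rowTotal # d ℕ.+ configTotal # D

  firstColumnTotal : Statistic → ∀ {n k v V A} → Config {suc n} {k} (v ∷ V) A → ℕ
  firstColumnTotal # ([] _)        = 0
  firstColumnTotal # ((t ∷ d) ∷ D) = # t ℕ.+ firstColumnTotal # D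

  #-1 : ∀ {n} → Vec ℤ n → ℕ
  #-1 = Vec.count (ℤ._≟ -1ℤ)

  count-∷ : ∀ {n} e (v : Vec ℤ n) → #-1 (e ∷ v) ≡ #-1 (e ∷ []) ℕ.+ #-1 v
  count-∷ e v with e ℤ.≟ -1ℤ
  ... | yes _ = refl
  ... | no  _ = refl

  count-++ : ∀ {m n} (u : Vec ℤ m) (v : Vec ℤ n) → #-1 (u Vec.++ v) ≡ #-1 u ℕ.+ #-1 v
  count-++ []      v = refl
  count-++ (e ∷ u) v = begin
    #-1 (e ∷ u Vec.++ v)
      ≡⟨ count-∷ e (u Vec.++ v) ⟩
    #-1 (e ∷ []) ℕ.+ #-1 (u Vec.++ v)
      ≡⟨ cong (#-1 (e ∷ []) ℕ.+_) (count-++ u v) ⟩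
    #-1 (e ∷ []) ℕ.+ (#-1 u ℕ.+ #-1 v)
      ≡⟨ ℕ.+-assoc (#-1 (e ∷ [])) _ _ ⟨
    #-1 (e ∷ []) ℕ.+ #-1 u ℕ.+ #-1 v
      ≡⟨ cong (ℕ._+ #-1 v) (count-∷ e u) ⟨
    #-1 (e ∷ u) ℕ.+ #-1 v ∎
    where open ≡-Reasoning

  count-prependColumn : ∀ {m n} (r : Vec ℤ n) (T : Vec (Vec ℤ m) n) →
    #-1 (Vec.concat (prependColumn r T)) ≡
    #-1 r ℕ.+ #-1 (Vec.concat T)
  count-prependColumn []      []      = refl
  count-prependColumn (e ∷ r) (c ∷ T) = begin
    #-1 (e ∷ c Vec.++ Vec.concat (prependColumn r T))
      ≡⟨ count-∷ e (c Vec.++ Vec.concat (prependColumn r T)) ⟩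
    #-1 (e ∷ []) ℕ.+ #-1 (c Vec.++ Vec.concat (prependColumn r T))
      ≡⟨ cong (#-1 (e ∷ []) ℕ.+_) (count-++ c _) ⟩
    #-1 (e ∷ []) ℕ.+ (#-1 c ℕ.+ #-1 (Vec.concat (prependColumn r T)))
      ≡⟨ cong (λ k → #-1 (e ∷ []) ℕ.+ (#-1 c ℕ.+ k)) (count-prependColumn r T) ⟩
    #-1 (e ∷ []) ℕ.+ (#-1 c ℕ.+ (#-1 r ℕ.+ #-1 (Vec.concat T)))
      ≡⟨ rearrange (#-1 (e ∷ [])) (#-1 c) (#-1 r) (#-1 (Vec.concat T)) ⟩
    (#-1 (e ∷ []) ℕ.+ #-1 r) ℕ.+ (#-1 c ℕ.+ #-1 (Vec.concat T))
      ≡⟨ cong₂ ℕ._+_ (count-∷ e r) (count-++ c (Vec.concat T)) ⟨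
    #-1 (e ∷ r) ℕ.+ #-1 (c Vec.++ Vec.concat T) ∎
    where
    open ≡-Reasoning
    rearrange : ∀ a b c d → a ℕ.+ (b ℕ.+ (c ℕ.+ d)) ≡ (a ℕ.+ c) ℕ.+ (b ℕ.+ d)
    rearrange = solve-∀

  Row-count : ∀ {n h V r V′} (d : Row {n} h V r V′) → #-1 r ≡ rowTotal #c₋ d
  Row-count []       = refl
  Row-count (a₀  ∷ d) = Row-count d
  Row-count (b₀₁ ∷ d) = Row-count d
  Row-count (b₁₀ ∷ d) = Row-count d
  Row-count (a₁  ∷ d) = Row-count d
  Row-count (c₊  ∷ d) = Row-count d
  Row-count (c₋  ∷ d) = cong suc (Row-count d)

  count-transpose : ∀ {n k V A} (D : Config {n} {k} V A) →
                 #-1 (Vec.concat (transpose A)) ≡ configTotal #c₋ D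
  count-transpose {n} ([] _) = empty-count n
    where
    empty-count : ∀ n → #-1 (Vec.concat (replicate n Vec.[])) ≡ 0
    empty-count zero    = refl
    empty-count (suc n) = empty-count n
  count-transpose {A = r ∷ A} (d ∷ D) =
    ≡.trans (count-prependColumn r (transpose A)) (cong₂ ℕ._+_ (Row-count d) (count-transpose D))

  -- Under empty columns the zeros before the one are `a₀` and those after it are `b₁₀`; an entry -1
  -- would need a true column.
  top-row-zeros : ∀ {n h r V′} (d : Row h (empty n) r V′) → h ≡ false →
                  zerosBeforeOne r ≡ rowTotal #a₀ d
  top-row-zeros {zero}  []       ()
  top-row-zeros {suc n} (a₀ ∷ d) _ = cong suc (top-row-zeros d refl)
  top-row-zeros {suc n} (c₊ ∷ d) _ = ≡.sym (after d)
    where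
    after : ∀ {n r V′} (d : Row true (empty n) r V′) → rowTotal #a₀ d ≡ 0
    after {zero}  []        = refl
    after {suc n} (b₁₀ ∷ d) = after d

  head-transpose : ∀ {n k} (e : ℤ) (r : Vec ℤ n) (A : Vec (Vec ℤ (suc n)) k) →
                   Vec.head (transpose ((e ∷ r) ∷ A)) ≡ e ∷ Vec.head (transpose A)
  head-transpose e r A with transpose A
  ... | c ∷ T = refl

  first-column-zeros : ∀ {n k V} {A : Vec (Vec ℤ (suc n)) k} (D : Config (false ∷ V) A) →
                       zerosBeforeOne (Vec.head (transpose A)) ≡ firstColumnTotal #a₀ D
  first-column-zeros ([] (() ∷ _))
  first-column-zeros {A = (_ ∷ r) ∷ A} ((a₀ ∷ d) ∷ D)
    rewrite head-transpose 0ℤ r A = cong suc (first-column-zeros D)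
  first-column-zeros {A = (_ ∷ r) ∷ A} ((c₊ ∷ d) ∷ D)
    rewrite head-transpose 1ℤ r A = ≡.sym (after D)
    where
    after : ∀ {n k V} {A : Vec (Vec ℤ (suc n)) k} (D : Config (true ∷ V) A) →
            firstColumnTotal #a₀ D ≡ 0
    after ([] _)          = refl
    after ((b₀₁ ∷ d) ∷ D) = after D

  Full : ∀ {n} → Vec Bool n → Set
  Full = All (_≡ true)

  -- When all columns end in true, the zeros left of the one are `b₀₁` and those right of it are
  -- `a₁`, so reading the row backwards counts the latter.
  bottom-row-zeros : ∀ {n V r V′} (d : Row {n} false V r V′) → Full V′ →
                     zerosBeforeOne (Vec.reverse r) ≡ rowTotal #a₁ d
  bottom-row-zeros {r = r} d full with split d full
    where
    split-after : ∀ {n V r V′} (d : Row {n} true V r V′) → Full V′ →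
                  toList r ≡ List.replicate (rowTotal #a₁ d) 0ℤ
    split-after []        _          = refl
    split-after (b₁₀ ∷ d) (() ∷ _)
    split-after (a₁  ∷ d) (_ ∷ full) = cong (0ℤ ∷_) (split-after d full)
    split-after (c₋  ∷ d) (() ∷ _)
    split : ∀ {n V r V′} (d : Row {n} false V r V′) → Full V′ →
            ∃ λ xs → toList r ≡ xs List.++ 1ℤ ∷ List.replicate (rowTotal #a₁ d) 0ℤ
    split (a₀  ∷ d) (() ∷ _)
    split (b₀₁ ∷ d) (_ ∷ full) = let xs , eq = split d full in 0ℤ ∷ xs , cong (0ℤ ∷_) eq
    split (c₊  ∷ d) (_ ∷ full) = [] , cong (1ℤ ∷_) (split-after d full)
  ... | xs , eq = begin
    zeros (toList (Vec.reverse r))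
      ≡⟨ cong zeros (Vec.toList-reverse r) ⟩
    zeros (List.reverse (toList r))
      ≡⟨ cong (zeros ∘ List.reverse) eq ⟩
    zeros (List.reverse (xs List.++ 1ℤ ∷ List.replicate j 0ℤ))
      ≡⟨ cong zeros (List.reverse-++ xs _) ⟩
    zeros (List.reverse (1ℤ ∷ List.replicate j 0ℤ) List.++ List.reverse xs)
      ≡⟨ cong (λ l → zeros (l List.++ List.reverse xs)) (List.unfold-reverse 1ℤ (List.replicate j 0ℤ)) ⟩
    zeros ((List.reverse (List.replicate j 0ℤ) List.++ 1ℤ ∷ []) List.++ List.reverse xs)
      ≡⟨ cong zeros (List.++-assoc (List.reverse (List.replicate j 0ℤ)) _ _) ⟩
    zeros (List.reverse (List.replicate j 0ℤ) List.++ 1ℤ ∷ List.reverse xs)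
      ≡⟨ cong (λ l → zeros (l List.++ 1ℤ ∷ List.reverse xs)) (reverse-replicate j) ⟩
    zeros (List.replicate j 0ℤ List.++ 1ℤ ∷ List.reverse xs)
      ≡⟨ zeros-replicate j ⟩
    j ∎
    where
    open ≡-Reasoning
    j = rowTotal #a₁ d
    zeros : List ℤ → ℕ
    zeros = List.length ∘ List.filter (ℤ._≟ 0ℤ) ∘ List.takeWhile (¬? ∘ (ℤ._≟ 1ℤ))
    zeros-replicate : ∀ j {xs} → zeros (List.replicate j 0ℤ List.++ 1ℤ ∷ xs) ≡ j
    zeros-replicate zero    = refl
    zeros-replicate (suc j) = cong suc (zeros-replicate j)
    replicate-∷ʳ : ∀ j → List.replicate j 0ℤ List.++ 0ℤ ∷ [] ≡ 0ℤ ∷ List.replicate j 0ℤ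
    replicate-∷ʳ zero    = refl
    replicate-∷ʳ (suc j) = cong (0ℤ ∷_) (replicate-∷ʳ j)
    reverse-replicate : ∀ j → List.reverse (List.replicate j 0ℤ) ≡ List.replicate j 0ℤ
    reverse-replicate zero    = refl
    reverse-replicate (suc j) = ≡.trans (List.unfold-reverse 0ℤ (List.replicate j 0ℤ))
      (≡.trans (cong (List._++ 0ℤ ∷ []) (reverse-replicate j)) (replicate-∷ʳ j))

  -- The inversion number.

  ⟦_⟧ : Bool → ℤ
  ⟦ false ⟧ = 0ℤ
  ⟦ true  ⟧ = 1ℤ

  Vertex-horizontal-sum : ∀ {h v e h′ v′} → Vertex h v e h′ v′ → ⟦ h ⟧ ℤ.+ e ≡ ⟦ h′ ⟧
  Vertex-horizontal-sum a₀  = refl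
  Vertex-horizontal-sum b₀₁ = refl
  Vertex-horizontal-sum b₁₀ = refl
  Vertex-horizontal-sum a₁  = refl
  Vertex-horizontal-sum c₊  = refl
  Vertex-horizontal-sum c₋  = refl

  Vertex-vertical-sum : ∀ {h v e h′ v′} → Vertex h v e h′ v′ → ⟦ v ⟧ ℤ.+ e ≡ ⟦ v′ ⟧
  Vertex-vertical-sum a₀  = refl
  Vertex-vertical-sum b₀₁ = refl
  Vertex-vertical-sum b₁₀ = refl
  Vertex-vertical-sum a₁  = refl
  Vertex-vertical-sum c₊  = refl
  Vertex-vertical-sum c₋  = refl

  -- The inversion number compares strictly in one direction and weakly in the other, hence the left
  -- sum excludes the entry and the column sum includes it. With `v` in place of `v′`, the vertex
  -- `c₋` would be counted too.
  Vertex-product : ∀ {h v e h′ v′} (t : Vertex h v e h′ v′) → ⟦ h ⟧ ℤ.* ⟦ v′ ⟧ ≡ + #a₁ t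
  Vertex-product a₀  = refl
  Vertex-product b₀₁ = refl
  Vertex-product b₁₀ = refl
  Vertex-product a₁  = refl
  Vertex-product c₊  = refl
  Vertex-product c₋  = refl

  before : ∀ {n} → Vec ℤ n → Fin n → ℤ
  before {n} r i′ = ∑[ i < n ] (if does (i Fin.<? i′) then lookup r i else 0ℤ)

  upTo : ∀ {k n} → Vec (Vec ℤ n) k → Fin k → Fin n → ℤ
  upTo {k} A j i = ∑[ j′ < k ] (if does (j′ Fin.≤? j) then lookup (lookup A j′) i else 0ℤ)

  before-zero : ∀ {n} (r : Vec ℤ (suc n)) → before r zero ≡ 0ℤ
  before-zero {n} r = ≡.trans (ℤ.+-identityˡ _) (sum-replicate-zero n)

  upTo-zero : ∀ {k n} (r : Vec ℤ n) (A : Vec (Vec ℤ n) k) i → upTo (r ∷ A) zero i ≡ lookup r i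
  upTo-zero {k} r A i = ≡.trans (cong (ℤ._+_ (lookup r i)) (sum-replicate-zero k)) (ℤ.+-identityʳ _)

  upTo-suc : ∀ {k n} (r : Vec ℤ n) (A : Vec (Vec ℤ n) k) j i →
             upTo (r ∷ A) (suc j) i ≡ lookup r i ℤ.+ upTo A j i
  upTo-suc r A j i = cong (ℤ._+_ (lookup r i)) (sum-cong-≗ λ j′ →
    cong (λ b → if b then lookup (lookup A j′) i else 0ℤ) (suc-≤? j′))
    where
    suc-≤? : ∀ j′ → does (suc j′ Fin.≤? suc j) ≡ does (j′ Fin.≤? j)
    suc-≤? zero     = refl
    suc-≤? (suc j′) = refl

  Row-product : ∀ {n h V r V′} (d : Row {n} h V r V′) →
                ∑[ i < n ] ((⟦ h ⟧ ℤ.+ before r i) ℤ.* ⟦ lookup V′ i ⟧) ≡ + rowTotal #a₁ d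
  Row-product []                                               = refl
  Row-product {suc n} {h} {r = e ∷ r} {v′ ∷ V′} (t ∷ d) = cong₂ ℤ._+_
    (≡.trans (cong (λ s → (⟦ h ⟧ ℤ.+ s) ℤ.* ⟦ v′ ⟧) (before-zero (e ∷ r)))
      (≡.trans (cong (ℤ._* ⟦ v′ ⟧) (ℤ.+-identityʳ ⟦ h ⟧)) (Vertex-product t)))
    (≡.trans (sum-cong-≗ λ i → cong (ℤ._* ⟦ lookup V′ i ⟧)
        (≡.trans (≡.sym (ℤ.+-assoc ⟦ h ⟧ e (before r i)))
                 (cong (ℤ._+ before r i) (Vertex-horizontal-sum t))))
      (Row-product d))

  Row-vertical-sum : ∀ {n h V r V′} → Row {n} h V r V′ →
                     ∀ i → ⟦ lookup V i ⟧ ℤ.+ lookup r i ≡ ⟦ lookup V′ i ⟧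
  Row-vertical-sum (t ∷ d) zero    = Vertex-vertical-sum t
  Row-vertical-sum (t ∷ d) (suc i) = Row-vertical-sum d i

  -- The term `⟦ lookup V i ⟧` makes the induction work: `upTo` of the lower rows no longer sees the
  -- top row, whose entries have been absorbed into the column sums.
  Config-product : ∀ {n k V A} (D : Config {n} {k} V A) →
    ∑[ j < k ] ∑[ i < n ] (before (lookup A j) i ℤ.* (⟦ lookup V i ⟧ ℤ.+ upTo A j i)) ≡ + configTotal #a₁ D
  Config-product ([] _) = refl
  Config-product {n} {suc k} {V} {r ∷ A} (_∷_ {V′ = V′} d D) = cong₂ ℤ._+_
    (≡.trans (sum-cong-≗ λ i → cong₂ ℤ._*_ (≡.sym (ℤ.+-identityˡ (before r i)))
        (≡.trans (cong (ℤ._+_ ⟦ lookup V i ⟧) (upTo-zero r A i)) (Row-vertical-sum d i)))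
      (Row-product d))
    (≡.trans (sum-cong-≗ λ j → sum-cong-≗ λ i → cong (ℤ._*_ (before (lookup A j) i))
        (≡.trans (cong (ℤ._+_ ⟦ lookup V i ⟧) (upTo-suc r A j i))
        (≡.trans (≡.sym (ℤ.+-assoc ⟦ lookup V i ⟧ (lookup r i) _))
                 (cong (ℤ._+ upTo A j i) (Row-vertical-sum d i)))))
      (Config-product D))

  -- For fixed `i′` and `j` the two conditions are independent, one restricting `i` and the other
  -- `j′`, so the double sum over these is a product.
  inversionSum-transpose : ∀ {n} (A : Matrix n) →
    inversionSum (transpose A) ≡ ∑[ j < n ] ∑[ i < n ] (before (lookup A j) i ℤ.* upTo A j i)
  inversionSum-transpose {n} A = begin
    inversionSum (transpose A)
      ≡⟨ (sum-cong-≗ λ i → sum-cong-≗ λ i′ → sum-cong-≗ λ j →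
           ≡.trans (sum-cong-≗ λ j′ → entry i i′ j j′)
                   (≡.sym (*-distribˡ-sum (f i i′ j) (g i′ j)))) ⟩
    ∑[ i < n ] ∑[ i′ < n ] ∑[ j < n ] (f i i′ j ℤ.* upTo A j i′)
      ≡⟨ ∑-comm (λ i i′ → ∑[ j < n ] (f i i′ j ℤ.* upTo A j i′)) ⟩
    ∑[ i′ < n ] ∑[ i < n ] ∑[ j < n ] (f i i′ j ℤ.* upTo A j i′)
      ≡⟨ (sum-cong-≗ λ i′ → ∑-comm (λ i j → f i i′ j ℤ.* upTo A j i′)) ⟩
    ∑[ i′ < n ] ∑[ j < n ] ∑[ i < n ] (f i i′ j ℤ.* upTo A j i′)
      ≡⟨ ∑-comm (λ i′ j → ∑[ i < n ] (f i i′ j ℤ.* upTo A j i′)) ⟩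
    ∑[ j < n ] ∑[ i′ < n ] ∑[ i < n ] (f i i′ j ℤ.* upTo A j i′)
      ≡⟨ (sum-cong-≗ λ j → sum-cong-≗ λ i′ →
           ≡.sym (*-distribʳ-sum (upTo A j i′) (λ i → f i i′ j))) ⟩
    ∑[ j < n ] ∑[ i′ < n ] (before (lookup A j) i′ ℤ.* upTo A j i′) ∎
    where
    open ≡-Reasoning
    f : Fin n → Fin n → Fin n → ℤ
    f i i′ j = if does (i Fin.<? i′) then A ⟨ j , i ⟩ else 0ℤ
    g : Fin n → Fin n → Fin n → ℤ
    g i′ j j′ = if does (j′ Fin.≤? j) then A ⟨ j′ , i′ ⟩ else 0ℤ
    if-* : ∀ p q (a b : ℤ) →
           (if p ∧ q then a ℤ.* b else 0ℤ) ≡ (if p then a else 0ℤ) ℤ.* (if q then b else 0ℤ)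
    if-* false q     a b = refl
    if-* true  false a b = ≡.sym (ℤ.*-zeroʳ a)
    if-* true  true  a b = refl
    entry : ∀ i i′ j j′ →
      (if does (i Fin.<? i′ ×-dec j′ Fin.≤? j) then transpose A ⟨ i , j ⟩ ℤ.* transpose A ⟨ i′ , j′ ⟩ else 0ℤ)
      ≡ f i i′ j ℤ.* g i′ j j′
    entry i i′ j j′ rewrite lookup-transpose A i j | lookup-transpose A i′ j′ =
      if-* (does (i Fin.<? i′)) (does (j′ Fin.≤? j)) (A ⟨ j , i ⟩) (A ⟨ j′ , i′ ⟩)

  ν-transpose : ∀ {n} {A : Matrix n} (D : Config (empty n) A) → ν (transpose A) ≡ configTotal #a₁ D
  ν-transpose {n} {A} D = cong ℤ.∣_∣ (begin
    inversionSum (transpose A)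
      ≡⟨ inversionSum-transpose A ⟩
    ∑[ j < n ] ∑[ i < n ] (before (lookup A j) i ℤ.* upTo A j i)
      ≡⟨ (sum-cong-≗ λ j → sum-cong-≗ λ i → cong (ℤ._*_ (before (lookup A j) i))
           (≡.trans (cong (λ v → ⟦ v ⟧ ℤ.+ upTo A j i) (Vec.lookup-replicate i false))
                    (ℤ.+-identityˡ _))) ⟨
    ∑[ j < n ] ∑[ i < n ] (before (lookup A j) i ℤ.* (⟦ lookup (empty n) i ⟧ ℤ.+ upTo A j i))
      ≡⟨ Config-product D ⟩
    + configTotal #a₁ D ∎)
    where open ≡-Reasoning

open Configurations

-- Sums over alternating sign matrices as partition functions.

-- Both lists are free of duplicates and have the same members, transposition being an involution on
-- alternating sign matrices.
ASM-transpose : ∀ n → List.map transpose (ASM n) ↭ ASM n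
ASM-transpose n = ∼bag⇒↭ (unique∧set⇒bag
  (Unique.map⁺ transpose-injective (ASM-unique n)) (ASM-unique n) (mk⇔ to from))
  where
  transpose-injective : ∀ {A B : Matrix n} → transpose A ≡ transpose B → A ≡ B
  transpose-injective eq =
    ≡.trans (≡.sym (transpose-involutive _)) (≡.trans (cong transpose eq) (transpose-involutive _))
  ∈-transpose : ∀ {A} → A ∈ ASM n → transpose A ∈ ASM n
  ∈-transpose A∈ = Equivalence.from ∈-ASM (transpose-IsASM (Equivalence.to ∈-ASM A∈))
  to : ∀ {A} → A ∈ List.map transpose (ASM n) → A ∈ ASM n
  to A∈ with ∈-map⁻ transpose A∈
  ... | B , B∈ , ≡.refl = ∈-transpose B∈
  from : ∀ {A} → A ∈ ASM n → A ∈ List.map transpose (ASM n)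
  from A∈ = subst (_∈ _) (transpose-involutive _) (∈-map⁺ transpose (∈-transpose A∈))

vertex : ∀ h v e → Maybe (∃₂ λ h′ v′ → Vertex h v e h′ v′)
vertex false false (+ 0)    = just (_ , _ , a₀)
vertex false true  (+ 0)    = just (_ , _ , b₀₁)
vertex true  false (+ 0)    = just (_ , _ , b₁₀)
vertex true  true  (+ 0)    = just (_ , _ , a₁)
vertex false false (+ 1)    = just (_ , _ , c₊)
vertex true  true  -[1+ 0 ] = just (_ , _ , c₋)
vertex _     _     _        = nothing

vertex-just : ∀ {h v e h′ v′} (t : Vertex h v e h′ v′) → vertex h v e ≡ just (h′ , v′ , t)
vertex-just a₀  = ≡.refl
vertex-just b₀₁ = ≡.refl
vertex-just b₁₀ = ≡.refl
vertex-just a₁  = ≡.refl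
vertex-just c₊  = ≡.refl
vertex-just c₋  = ≡.refl

module Expansion {c ℓ} (R : CommutativeRing c ℓ) where

  open CommutativeRing R
  open IntegerCoefficientSolver R
  open Transfer R
  open ExchangeFormulas rawRing using (homogeneous; inhomogeneous)
  open GeneratingFunctions R using (sumASM)
  open import Relation.Binary.Reasoning.Setoid setoid

  sumOver : ∀ {a} {A : Set a} → List A → (A → Carrier) → Carrier
  sumOver xs f = List.foldr _+_ 0# (List.map f xs)

  module _ {a} {A : Set a} where

    sumOver-cong : ∀ (xs : List A) {f g} → (∀ x → f x ≈ g x) → sumOver xs f ≈ sumOver xs g
    sumOver-cong []       eq = refl
    sumOver-cong (x ∷ xs) eq = +-cong (eq x) (sumOver-cong xs eq)

    sumOver-* : ∀ (xs : List A) k f → sumOver xs (λ x → k * f x) ≈ k * sumOver xs f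
    sumOver-* []       k f = sym (zeroʳ k)
    sumOver-* (x ∷ xs) k f = trans (+-congˡ (sumOver-* xs k f)) (sym (distribˡ k _ _))

    sumOver-0 : ∀ (xs : List A) → sumOver xs (λ _ → 0#) ≈ 0#
    sumOver-0 []       = refl
    sumOver-0 (x ∷ xs) = trans (+-identityˡ _) (sumOver-0 xs)

    sumOver-++ : ∀ (xs ys : List A) f → sumOver (xs List.++ ys) f ≈ sumOver xs f + sumOver ys f
    sumOver-++ []       ys f = sym (+-identityˡ _)
    sumOver-++ (x ∷ xs) ys f = trans (+-congˡ (sumOver-++ xs ys f)) (sym (+-assoc _ _ _))

    sumOver-filter : ∀ {p} {P : A → Set p} (P? : ∀ x → Dec (P x)) xs {f g} →
                     (∀ x → P x → f x ≈ g x) → (∀ x → ¬ P x → g x ≈ 0#) →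
                     sumOver (List.filter P? xs) f ≈ sumOver xs g
    sumOver-filter P? []       f≈g g≈0 = refl
    sumOver-filter P? (x ∷ xs) f≈g g≈0 with P? x
    ... | yes px = +-cong (f≈g x px) (sumOver-filter P? xs f≈g g≈0)
    ... | no ¬px =
      trans (sumOver-filter P? xs f≈g g≈0) (sym (trans (+-congʳ (g≈0 x ¬px)) (+-identityˡ _)))

  sumOver-map : ∀ {a b} {A : Set a} {B : Set b} (h : A → B) xs f →
                sumOver (List.map h xs) f ≡ sumOver xs (f ∘ h)
  sumOver-map h xs f = cong (List.foldr _+_ 0#) (≡.sym (List.map-∘ xs))

  sumOver-cartesian : ∀ {a b d} {A : Set a} {B : Set b} {D : Set d} (h : A → B → D) xs ys f →
                      sumOver (cartesianProductWith h xs ys) f ≈ sumOver xs (λ x → sumOver ys (λ y → f (h x y)))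
  sumOver-cartesian h []       ys f = refl
  sumOver-cartesian h (x ∷ xs) ys f = trans (sumOver-++ (List.map (h x) ys) _ f)
    (+-cong (reflexive (sumOver-map (h x) ys f)) (sumOver-cartesian h xs ys f))

  sumOver-↭ : ∀ {a} {A : Set a} {xs ys : List A} → xs ↭ ys → ∀ f → sumOver xs f ≈ sumOver ys f
  sumOver-↭ p f = ↭ₛ.foldr-commMonoid setoid +-isCommutativeMonoid (↭-reflexive (↭.map⁺ f p))
    where
    open import Data.List.Relation.Binary.Permutation.Setoid setoid using () renaming (_↭_ to _↭ₛ_)
    ↭-reflexive : ∀ {us vs : List Carrier} → us ↭ vs → us ↭ₛ vs
    ↭-reflexive q = Homogeneous.map reflexive (↭⇒↭ₛ q)

  sumASM-transpose : ∀ n f → sumASM n f ≈ sumASM n (f ∘ transpose)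
  sumASM-transpose n f =
    trans (sym (sumOver-↭ (ASM-transpose n) f)) (reflexive (sumOver-map transpose (ASM n) f))

  weight : ∀ {h v e h′ v′} → Weights Carrier → Vertex h v e h′ v′ → Carrier
  weight w a₀  = Weights.a₀ w
  weight w b₀₁ = Weights.b w
  weight w b₁₀ = Weights.b w
  weight w a₁  = Weights.a₁ w
  weight w c₊  = Weights.c₊ w
  weight w c₋  = Weights.c₋ w

  -- The weight of a single row, extended by zero to vectors that admit no row. Sums can then run
  -- over all vectors of entries, where they split entry by entry.
  rowWeight : ∀ {m} → RowWeights m → Bool → Vec Bool m → Vec ℤ m →
              (Vec Bool m → Carrier) → Carrier
  rowWeight []       false []      []      f = 0#
  rowWeight []       true  []      []      f = f []
  rowWeight (w ∷ ws) h     (v ∷ V) (e ∷ r) f =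
    maybe′ (λ (h′ , v′ , t) → weight w t * rowWeight ws h′ V r (f ∘ (v′ ∷_))) 0# (vertex h v e)

  rowProduct : ∀ {m h V r V′} → RowWeights m → Row {m} h V r V′ → Carrier
  rowProduct []       []      = 1#
  rowProduct (w ∷ ws) (t ∷ d) = weight w t * rowProduct ws d

  rowWeight-Row : ∀ {m h V r V′} (ws : RowWeights m) (d : Row {m} h V r V′)
                  (f : Vec Bool m → Carrier) →
                  rowWeight ws h V r f ≈ rowProduct ws d * f V′
  rowWeight-Row []       []      f = sym (*-identityˡ _)
  rowWeight-Row (w ∷ ws) (t ∷ d) f
    rewrite vertex-just t = trans (*-congˡ (rowWeight-Row ws d _)) (sym (*-assoc _ _ _))

  -- The entries and the incoming states determine the outgoing ones, so `rowWeight` either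
  -- evaluates its continuation at a single point or vanishes. Congruence and exchange with sums
  -- follow from this dichotomy.
  rowWeight-zero : ∀ {m} (ws : RowWeights m) h V r →
                   (∃ λ V′ → Row h V r V′) ⊎ (∀ f → rowWeight ws h V r f ≈ 0#)
  rowWeight-zero []       false []      []      = inj₂ λ f → refl
  rowWeight-zero []       true  []      []      = inj₁ ([] , [])
  rowWeight-zero (w ∷ ws) h     (v ∷ V) (e ∷ r) with vertex h v e
  ... | nothing            = inj₂ λ f → refl
  ... | just (h′ , v′ , t) with rowWeight-zero ws h′ V r
  ...   | inj₁ (V′ , d) = inj₁ (v′ ∷ V′ , t ∷ d)
  ...   | inj₂ eq       = inj₂ λ f → trans (*-congˡ (eq _)) (zeroʳ _)

  rowWeight-cong : ∀ {m} (ws : RowWeights m) h V r {f g} → (∀ V′ → f V′ ≈ g V′) →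
                   rowWeight ws h V r f ≈ rowWeight ws h V r g
  rowWeight-cong ws h V r {f} {g} eq with rowWeight-zero ws h V r
  ... | inj₁ (V′ , d) =
    trans (rowWeight-Row ws d f) (trans (*-congˡ (eq V′)) (sym (rowWeight-Row ws d g)))
  ... | inj₂ zero≈    = trans (zero≈ f) (sym (zero≈ g))

  sumOver-rowWeight : ∀ {m a} {A : Set a} (ws : RowWeights m) h V r xs
                      (φ : A → Vec Bool m → Carrier) →
                      sumOver xs (λ x → rowWeight ws h V r (φ x)) ≈
                      rowWeight ws h V r (λ V′ → sumOver xs (λ x → φ x V′))
  sumOver-rowWeight ws h V r xs φ with rowWeight-zero ws h V r
  ... | inj₁ (V′ , d) = begin
    sumOver xs (λ x → rowWeight ws h V r (φ x))           ≈⟨ sumOver-cong xs (λ x → rowWeight-Row ws d (φ x)) ⟩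
    sumOver xs (λ x → rowProduct ws d * φ x V′)           ≈⟨ sumOver-* xs _ _ ⟩
    rowProduct ws d * sumOver xs (λ x → φ x V′)           ≈⟨ rowWeight-Row ws d _ ⟨
    rowWeight ws h V r (λ V′ → sumOver xs (λ x → φ x V′)) ∎
  ... | inj₂ zero≈    = trans (sumOver-cong xs (λ x → zero≈ (φ x))) (trans (sumOver-0 xs) (sym (zero≈ _)))

  rowWeight-sum : ∀ {m} (ws : RowWeights m) h V f →
                  sumOver (vecsOver entries m) (λ r → rowWeight ws h V r f) ≈ row ws h V f
  rowWeight-sum []       false []      f = +-identityʳ _
  rowWeight-sum []       true  []      f = +-identityʳ _
  rowWeight-sum {suc m} (w ∷ ws) h (v ∷ V) f = begin
    sumOver (vecsOver entries (suc m)) (λ r → rowWeight (w ∷ ws) h (v ∷ V) r f)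
      ≈⟨ sumOver-cartesian _∷_ entries (vecsOver entries m) _ ⟩
    sumOver entries (λ e → sumOver (vecsOver entries m) (λ r → rowWeight (w ∷ ws) h (v ∷ V) (e ∷ r) f))
      ≈⟨ sumOver-cong entries perEntry ⟩
    sumOver entries (entrySum h v)
      ≈⟨ collect h v ⟩
    row (w ∷ ws) h (v ∷ V) f ∎
    where
    entrySum : Bool → Bool → ℤ → Carrier
    entrySum h v e = maybe′ (λ (h′ , v′ , t) → weight w t * row ws h′ V (f ∘ (v′ ∷_))) 0# (vertex h v e)
    perEntry : ∀ e → sumOver (vecsOver entries m) (λ r → rowWeight (w ∷ ws) h (v ∷ V) (e ∷ r) f) ≈
               entrySum h v e
    perEntry e with vertex h v e
    ... | nothing            = sumOver-0 (vecsOver entries m)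
    ... | just (h′ , v′ , t) =
      trans (sumOver-* (vecsOver entries m) _ _) (*-congˡ (rowWeight-sum ws h′ V _))
    collect : ∀ h v → sumOver entries (entrySum h v) ≈ row (w ∷ ws) h (v ∷ V) f
    drop : ∀ {p q} → p + (q + (0# + 0#)) ≈ p + q
    drop = +-congˡ (trans (+-congˡ (+-identityˡ 0#)) (+-identityʳ _))
    collect false false = drop
    collect false true  = trans drop (+-identityʳ _)
    collect true  false = trans drop (+-identityʳ _)
    collect true  true  = +-congˡ (trans (+-identityˡ _) (+-identityʳ _))

  configWeight : ∀ {n k} → Vec (RowWeights n) k → Vec Bool n → Vec (Vec ℤ n) k → Carrier
  configWeight []         V []      = δ V
  configWeight (ws ∷ wss) V (r ∷ A) = rowWeight ws false V r (λ V′ → configWeight wss V′ A)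

  configProduct : ∀ {n k V} {A : Vec (Vec ℤ n) k} → Vec (RowWeights n) k → Config V A → Carrier
  configProduct []         ([] _)  = 1#
  configProduct (ws ∷ wss) (d ∷ D) = rowProduct ws d * configProduct wss D

  configWeight-sum : ∀ {n k} (wss : Vec (RowWeights n) k) V →
                     sumOver (vecsOver (vecsOver entries n) k) (configWeight wss V) ≈ partition wss V
  configWeight-sum []         V = +-identityʳ _
  configWeight-sum {n} {suc k} (ws ∷ wss) V = begin
    sumOver (vecsOver (vecsOver entries n) (suc k)) (configWeight (ws ∷ wss) V)
      ≈⟨ sumOver-cartesian _∷_ (vecsOver entries n) As _ ⟩
    sumOver (vecsOver entries n) (λ r → sumOver As (λ A → rowWeight ws false V r (λ V′ → configWeight wss V′ A)))
      ≈⟨ sumOver-cong (vecsOver entries n) (λ r → trans (sumOver-rowWeight ws false V r As _)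
           (rowWeight-cong ws false V r (configWeight-sum wss))) ⟩
    sumOver (vecsOver entries n) (λ r → rowWeight ws false V r (partition wss))
      ≈⟨ rowWeight-sum ws false V _ ⟩
    partition (ws ∷ wss) V ∎
    where As = vecsOver (vecsOver entries n) k

  δ-Full : ∀ {m} {V : Vec Bool m} → Full V → δ V ≈ 1#
  δ-Full []                = refl
  δ-Full (≡.refl ∷ full) = δ-Full full

  δ-zero : ∀ {m} (V : Vec Bool m) → Full V ⊎ δ V ≈ 0#
  δ-zero []          = inj₁ []
  δ-zero (false ∷ V) = inj₂ refl
  δ-zero (true ∷ V) with δ-zero V
  ... | inj₁ full = inj₁ (≡.refl ∷ full)
  ... | inj₂ eq   = inj₂ eq

  configWeight-Config : ∀ {n k V} {A : Vec (Vec ℤ n) k} wss (D : Config V A) →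
                        configWeight wss V A ≈ configProduct wss D
  configWeight-Config []         ([] full) = δ-Full full
  configWeight-Config (ws ∷ wss) (d ∷ D)   = trans (rowWeight-Row ws d _) (*-congˡ (configWeight-Config wss D))

  configWeight-zero : ∀ {n k} wss V (A : Vec (Vec ℤ n) k) → Config V A ⊎ configWeight wss V A ≈ 0#
  configWeight-zero []         V [] with δ-zero V
  ... | inj₁ full = inj₁ ([] full)
  ... | inj₂ eq   = inj₂ eq
  configWeight-zero (ws ∷ wss) V (r ∷ A) with rowWeight-zero ws false V r
  ... | inj₂ eq       = inj₂ (eq _)
  ... | inj₁ (V′ , d) with configWeight-zero wss V′ A
  ...   | inj₁ D  = inj₁ (d ∷ D)
  ...   | inj₂ eq = inj₂ (trans (rowWeight-Row ws d _) (trans (*-congˡ eq) (zeroʳ _)))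

  -- The filtered sum equals the unfiltered sum of `configWeight`, which vanishes on every matrix
  -- without a configuration, that is, off the alternating sign matrices.
  sumASM-partition : ∀ n (f : Matrix n → Carrier) wss →
                     (∀ {A} (D : Config (empty n) A) → f A ≈ configProduct wss D) →
                     sumASM n f ≈ partition wss (empty n)
  sumASM-partition n f wss f≈ = trans
    (sumOver-filter isASM? (vecsOver (vecsOver entries n) n)
      (λ A asm → let D = IsASM⇒Config asm in trans (f≈ D) (sym (configWeight-Config wss D)))
      vanish)
    (configWeight-sum wss (empty n))
    where
    vanish : ∀ A → ¬ IsASM A → configWeight wss (empty n) A ≈ 0#
    vanish A ¬asm with configWeight-zero wss (empty n) A
    ... | inj₁ D  = contradiction (Config⇒IsASM D) ¬asm
    ... | inj₂ eq = eq

  open import Algebra.Properties.CommutativeSemigroup *-commutativeSemigroup using (interchange)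
  open import Algebra.Properties.Semiring.Exp semiring using (_^_; ^-homo-*)

  -- The generating functions as partition functions.

  module Monomials (x y z₁ z₂ : Carrier) where

    open Boundary x y z₁ z₂
    open GeneratingFunctions R using (Z; Zadj; Z̃adj)

    xy : ℕ → ℕ → Carrier
    xy a b = x ^ a * y ^ b

    xy-* : ∀ a b c d → xy a b * xy c d ≈ xy (a ℕ.+ c) (b ℕ.+ d)
    xy-* a b c d =
      trans (interchange (x ^ a) (y ^ b) (x ^ c) (y ^ d)) (sym (*-cong (^-homo-* x a c) (^-homo-* y b d)))

    rowXY : ∀ {m h V r V′} → Row {m} h V r V′ → Carrier
    rowXY d = xy (rowTotal #a₁ d) (rowTotal #c₋ d)

    configXY : ∀ {m k V A} → Config {m} {k} V A → Carrier
    configXY D = xy (configTotal #a₁ D) (configTotal #c₋ D)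

    configXY-∷ : ∀ {m k V r V′} {A : Vec (Vec ℤ m) k} (d : Row false V r V′) (D : Config V′ A) →
                 rowXY d * configXY D ≈ configXY (d ∷ D)
    configXY-∷ d D = xy-* (rowTotal #a₁ d) (rowTotal #c₋ d) (configTotal #a₁ D) (configTotal #c₋ D)

    bulk-vertex : ∀ {h v e h′ v′} (t : Vertex h v e h′ v′) → weight ο t ≈ xy (#a₁ t) (#c₋ t)
    bulk-vertex a₀  = sym (*-identityˡ 1#)
    bulk-vertex b₀₁ = sym (*-identityˡ 1#)
    bulk-vertex b₁₀ = sym (*-identityˡ 1#)
    bulk-vertex a₁  = sym (trans (*-identityʳ _) (*-identityʳ x))
    bulk-vertex c₊  = sym (*-identityˡ 1#)
    bulk-vertex c₋  = sym (trans (*-identityˡ _) (*-identityʳ y))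

    bulk-row : ∀ {m h V r V′} (d : Row {m} h V r V′) → rowProduct (replicate m ο) d ≈ rowXY d
    bulk-row []      = sym (*-identityˡ 1#)
    bulk-row (t ∷ d) =
      trans (*-cong (bulk-vertex t) (bulk-row d)) (xy-* (#a₁ t) (#c₋ t) (rowTotal #a₁ d) (rowTotal #c₋ d))

    bulk-config : ∀ {m k V A} (D : Config {m} {k} V A) →
                  configProduct (replicate k (replicate m ο)) D ≈ configXY D
    bulk-config ([] _)  = sym (*-identityˡ 1#)
    bulk-config (d ∷ D) = trans (*-cong (bulk-row d) (bulk-config D)) (configXY-∷ d D)

    z₁-∷ : ∀ {m k e h v v′ V r V′} {A : Vec (Vec ℤ (suc m)) k}
           (t : Vertex false v e h v′) (d : Row {m} h V r V′) (D : Config (v′ ∷ V′) A) →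
           z₁ ^ #a₀ t * z₁ ^ firstColumnTotal #a₀ D ≈ z₁ ^ firstColumnTotal #a₀ ((t ∷ d) ∷ D)
    z₁-∷ t d D = sym (^-homo-* z₁ (#a₀ t) (firstColumnTotal #a₀ D))

    edge-row : ∀ {m v e v′ h V r V′} (t : Vertex false v e h v′) (d : Row {m} h V r V′) →
               rowProduct edge (t ∷ d) ≈ rowXY (t ∷ d) * z₁ ^ #a₀ t
    edge-row a₀  d = trans (*-comm _ _) (*-cong (bulk-row d) (sym (*-identityʳ z₁)))
    edge-row b₀₁ d = trans (*-comm _ _) (*-congʳ (bulk-row d))
    edge-row c₊  d = trans (*-comm _ _) (*-congʳ (bulk-row d))

    edge-config : ∀ {m k v V A} (D : Config {suc m} {k} (v ∷ V) A) →
                  configProduct (replicate k edge) D ≈ configXY D * z₁ ^ firstColumnTotal #a₀ D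
    edge-config ([] _) = sym (trans (*-identityʳ _) (*-identityˡ 1#))
    edge-config (_∷_ d@(t ∷ d′) D) = begin
      rowProduct edge d * configProduct (replicate _ edge) D
        ≈⟨ *-cong (edge-row t d′) (edge-config D) ⟩
      (rowXY d * z₁ ^ #a₀ t) * (configXY D * z₁ ^ firstColumnTotal #a₀ D)
        ≈⟨ interchange _ _ _ _ ⟩
      (rowXY d * configXY D) * (z₁ ^ #a₀ t * z₁ ^ firstColumnTotal #a₀ D)
        ≈⟨ *-cong (configXY-∷ d D) (z₁-∷ t d′ D) ⟩
      configXY (d ∷ D) * z₁ ^ firstColumnTotal #a₀ (d ∷ D) ∎

    -- Under empty columns only `a₀`, `b₁₀` and `c₊` occur, with inhomogeneous weights `z₂`, 1 and
    -- 1, so a pure power of `z₂` results.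
    top-row : ∀ {m h r V′} (d : Row {m} h (empty m) r V′) →
              rowProduct (replicate m ω) d ≈ rowXY d * z₂ ^ rowTotal #a₀ d
    top-row {zero}  []        = sym (trans (*-identityʳ _) (*-identityˡ 1#))
    top-row {suc m} (a₀ ∷ d)  = trans (*-congˡ (top-row d)) (move _ _ _)
      where
      move : ∀ p q r → p * (q * r) ≈ q * (p * r)
      move = solve 3 (λ p q r → p :* (q :* r) := q :* (p :* r)) refl
    top-row {suc m} (b₁₀ ∷ d) = trans (*-identityˡ _) (top-row d)
    top-row {suc m} (c₊ ∷ d)  = trans (*-identityˡ _) (top-row d)

    -- A zero in the corner counts for the top row and for the first column, hence its weight
    -- `z₁ * z₂`.
    special-top-row : ∀ {m e v′ h r V′} (t : Vertex false false e h v′) (d : Row {m} h (empty m) r V′) →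
      rowProduct (special (z₁ * z₂) 1# 1#) (t ∷ d) ≈
      rowXY (t ∷ d) * z₁ ^ #a₀ t * z₂ ^ rowTotal #a₀ (t ∷ d)
    special-top-row a₀ d = trans (*-congˡ (top-row d)) (move z₁ z₂ _ _)
      where
      move : ∀ p q r s → p * q * (r * s) ≈ r * (p * 1#) * (q * s)
      move = solve 4 (λ p q r s → p :* q :* (r :* s) := r :* (p :* con (1 , 0)) :* (q :* s)) refl
    special-top-row c₊ d = trans (*-identityˡ _) (trans (top-row d) (*-congʳ (sym (*-identityʳ _))))

    top-config : ∀ {m k r A} (D : Config {suc m} {suc k} (empty (suc m)) (r ∷ A)) →
      configProduct (special (z₁ * z₂) 1# 1# ∷ replicate k edge) D ≈
      configXY D * z₁ ^ firstColumnTotal #a₀ D * z₂ ^ zerosBeforeOne r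
    top-config {k = k} {r} (_∷_ d@(t ∷ d′) D) = begin
      rowProduct (special (z₁ * z₂) 1# 1#) d * configProduct (replicate k edge) D
        ≈⟨ *-cong (special-top-row t d′) (edge-config D) ⟩
      (rowXY d * z₁ ^ #a₀ t * z₂ ^ rowTotal #a₀ d) * (configXY D * z₁ ^ firstColumnTotal #a₀ D)
        ≈⟨ move _ _ _ _ _ ⟩
      (rowXY d * configXY D) * (z₁ ^ #a₀ t * z₁ ^ firstColumnTotal #a₀ D) * z₂ ^ rowTotal #a₀ d
        ≈⟨ *-cong (*-cong (configXY-∷ d D) (z₁-∷ t d′ D))
                  (reflexive (cong (z₂ ^_) (≡.sym (top-row-zeros d ≡.refl)))) ⟩
      configXY (d ∷ D) * z₁ ^ firstColumnTotal #a₀ (d ∷ D) * z₂ ^ zerosBeforeOne r ∎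
      where
      move : ∀ p q r s t → p * q * r * (s * t) ≈ p * s * (q * t) * r
      move = solve 5 (λ p q r s t → p :* q :* r :* (s :* t) := p :* s :* (q :* t) :* r) refl

    -- Full columns leave only `b₀₁`, `a₁` and `c₊`, and `a₁` has weight `x * z₂`: the factor `x`
    -- belongs to the inversion number, the factor `z₂` to the zeros after the one.
    bottom-row : ∀ {m h V r V′} (d : Row {m} h V r V′) → Full V′ →
                 rowProduct (replicate m ω) d ≈ rowXY d * z₂ ^ rowTotal #a₁ d
    bottom-row []        _          = sym (trans (*-identityʳ _) (*-identityˡ 1#))
    bottom-row (a₀ ∷ d)  (() ∷ _)
    bottom-row (b₀₁ ∷ d) (_ ∷ full) = trans (*-identityˡ _) (bottom-row d full)
    bottom-row (b₁₀ ∷ d) (() ∷ _)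
    bottom-row (a₁ ∷ d)  (_ ∷ full) = trans (*-congˡ (bottom-row d full)) (move x z₂ _ _ _)
      where
      move : ∀ p q r s t → p * q * (r * s * t) ≈ p * r * s * (q * t)
      move = solve 5 (λ p q r s t → p :* q :* (r :* s :* t) := p :* r :* s :* (q :* t)) refl
    bottom-row (c₊ ∷ d)  (_ ∷ full) = trans (*-identityˡ _) (bottom-row d full)
    bottom-row (c₋ ∷ d)  (() ∷ _)

    special-bottom-row : ∀ {m e v v′ h V r V′} (t : Vertex false v e h v′) (d : Row {m} h V r V′) →
      Full (v′ ∷ V′) →
      rowProduct (special 1# 1# 1#) (t ∷ d) ≈
      rowXY (t ∷ d) * z₁ ^ #a₀ t * z₂ ^ rowTotal #a₁ (t ∷ d)
    special-bottom-row a₀  d (() ∷ _)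
    special-bottom-row b₀₁ d (_ ∷ full) =
      trans (*-identityˡ _) (trans (bottom-row d full) (*-congʳ (sym (*-identityʳ _))))
    special-bottom-row c₊  d (_ ∷ full) =
      trans (*-identityˡ _) (trans (bottom-row d full) (*-congʳ (sym (*-identityʳ _))))

    zerosAfterOne : ∀ {n} → Vec ℤ n → ℕ
    zerosAfterOne r = zerosBeforeOne (Vec.reverse r)

    bottom-config : ∀ {m} k {v V A} (D : Config {suc m} {suc k} (v ∷ V) A) →
      configProduct (rowInserted k (special 1# 1# 1#)) D ≈
      configXY D * z₁ ^ firstColumnTotal #a₀ D * z₂ ^ zerosAfterOne (Vec.last A)
    bottom-config zero {A = r ∷ []} (_∷_ d@(t ∷ d′) ([] full)) = begin
      rowProduct (special 1# 1# 1#) d * 1#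
        ≈⟨ *-identityʳ _ ⟩
      rowProduct (special 1# 1# 1#) d
        ≈⟨ special-bottom-row t d′ full ⟩
      rowXY d * z₁ ^ #a₀ t * z₂ ^ rowTotal #a₁ d
        ≈⟨ reflexive (cong₂ _*_
             (cong₂ _*_ (cong₂ xy (pad (rowTotal #a₁ d)) (pad (rowTotal #c₋ d)))
                        (cong (z₁ ^_) (pad (#a₀ t))))
             (cong (z₂ ^_) (≡.sym (bottom-row-zeros d full)))) ⟩
      xy (rowTotal #a₁ d ℕ.+ 0) (rowTotal #c₋ d ℕ.+ 0) * z₁ ^ (#a₀ t ℕ.+ 0) * z₂ ^ zerosAfterOne r ∎
      where
      pad : ∀ n → n ≡ n ℕ.+ 0
      pad n = ≡.sym (ℕ.+-identityʳ n)
    bottom-config (suc k) {A = _ ∷ A@(_ ∷ _)} (_∷_ d@(t ∷ d′) D) = begin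
      rowProduct edge d * configProduct (rowInserted k (special 1# 1# 1#)) D
        ≈⟨ *-cong (edge-row t d′) (bottom-config k D) ⟩
      (rowXY d * z₁ ^ #a₀ t) *
      (configXY D * z₁ ^ firstColumnTotal #a₀ D * z₂ ^ zerosAfterOne (Vec.last A))
        ≈⟨ move _ _ _ _ _ ⟩
      (rowXY d * configXY D) * (z₁ ^ #a₀ t * z₁ ^ firstColumnTotal #a₀ D) * z₂ ^ zerosAfterOne (Vec.last A)
        ≈⟨ *-congʳ (*-cong (configXY-∷ d D) (z₁-∷ t d′ D)) ⟩
      configXY (d ∷ D) * z₁ ^ firstColumnTotal #a₀ (d ∷ D) * z₂ ^ zerosAfterOne (Vec.last A) ∎
      where
      move : ∀ p q r s t → p * q * (r * s * t) ≈ p * r * (q * s) * t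
      move = solve 5 (λ p q r s t → p :* q :* (r :* s :* t) := p :* r :* (q :* s) :* t) refl

    Z-partition : ∀ m → Z m x y ≈ bulk m m (empty m)
    Z-partition m = trans (sumASM-transpose m _)
      (sumASM-partition m _ (replicate m (replicate m ο)) λ D →
      trans (reflexive (cong₂ xy (ν-transpose D) (count-transpose D))) (sym (bulk-config D)))

    -- After transposition `ρT` reads the first column, which carries `z₁`, and `ρL` the top row,
    -- which carries `z₂`.
    Zadj-partition : ∀ m → Zadj (suc m) x y z₁ z₂ ≈
                     partition (special (z₁ * z₂) 1# 1# ∷ replicate m edge) (empty (suc m))
    Zadj-partition m = trans (sumASM-transpose (suc m) _)
      (sumASM-partition (suc m) _ (special (z₁ * z₂) 1# 1# ∷ replicate m edge) monomial)
      where
      monomial : ∀ {A : Matrix (suc m)} (D : Config (empty (suc m)) A) →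
        xy (ν (transpose A)) (μ (transpose A)) * z₁ ^ ρT (transpose A) * z₂ ^ ρL (transpose A) ≈
        configProduct (special (z₁ * z₂) 1# 1# ∷ replicate m edge) D
      monomial {r ∷ A} D = trans (reflexive (cong₂ _*_
          (cong₂ _*_ (cong₂ xy (ν-transpose D) (count-transpose D)) (cong (z₁ ^_) (first-column-zeros D)))
          (cong (λ B → z₂ ^ zerosBeforeOne (Vec.head B)) (transpose-involutive (r ∷ A)))))
        (sym (top-config D))

    Z̃adj-partition : ∀ m → Z̃adj (suc m) x y z₁ z₂ ≈
                     partition (rowInserted m (special 1# 1# 1#)) (empty (suc m))
    Z̃adj-partition m = trans (sumASM-transpose (suc m) _)
      (sumASM-partition (suc m) _ (rowInserted m (special 1# 1# 1#)) monomial)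
      where
      monomial : ∀ {A : Matrix (suc m)} (D : Config (empty (suc m)) A) →
        xy (ν (transpose A)) (μ (transpose A)) * z₁ ^ ρT (transpose A) * z₂ ^ ρR (transpose A) ≈
        configProduct (rowInserted m (special 1# 1# 1#)) D
      monomial {A} D = trans (reflexive (cong₂ _*_
          (cong₂ _*_ (cong₂ xy (ν-transpose D) (count-transpose D)) (cong (z₁ ^_) (first-column-zeros D)))
          (cong (λ B → z₂ ^ zerosAfterOne (Vec.last B)) (transpose-involutive A))))
        (sym (bottom-config m D))

corollary7 : ∀ {c ℓ} (R : CommutativeRing c ℓ) →
    let open CommutativeRing R
        open GeneratingFunctions R
    in
    (x y z₁ z₂ : Carrier) (m : ℕ) →
    let n = suc (suc m) in
    ((z₁ - 1#) * (z₂ - 1#) - y * z₁ * z₂) * Zadj n x y z₁ z₂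
      - (x * ((z₁ - 1#) * (z₂ - 1#)) - y) * (z₁ * z₂) * Z̃adj n x y z₁ z₂
    ≈ (z₁ - 1#) * (z₂ - 1#) * (1# - (x * z₁ * z₂) ^ n) * Z (n ∸ 1) x y
corollary7 R x y z₁ z₂ m =
  trans (+-cong (*-congˡ (Zadj-partition (suc m))) (-‿cong (*-congˡ (Z̃adj-partition (suc m)))))
    (trans (boundary-relation (suc m)) (*-congˡ (sym (Z-partition (suc m)))))
  where
  open CommutativeRing R
  open Expansion R
  open Monomials x y z₁ z₂
  open Transfer R
  open Boundary x y z₁ z₂
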